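{- For a positive integer $k$, let $A_k(n)$ be defined by $$\sum_{n=0}^{\infty}A_k(n)q^n=\frac{1}{(-q;q)_\infty(-q^k;q^k)_\infty}=(q;q^2)_\infty(q^k;q^{2k})_\infty,$$ equivalently $A_k(n)=a_e^k(n)-a_o^k(n)$, where $a_e^k(n)$ (resp. $a_o^k(n)$) is the number of partitions of $n$ into an even (resp. odd) number of parts in which the parts that are multiples of $k$ may appear in two colours. Then: (i) for all $n\ge0$, $A_7(2n+1)\equiv A_7(8n+3)\pmod 2$; (ii) for all $n\ge0$ and $j\ge0$, $A_7\!\left(2^{2j+3}n+\frac{10\cdot 2^{2j+1}+1}{3}\right)\equiv 0\pmod 2$; (iii) for all $n\ge0$, $A_7(16n+r)\equiv 0\pmod 2$ for $r\in\{9,13\}$; (iv) for all $n\ge0$ and $\alpha\ge0$, $A_7\!\left(2\cdot 7^{\alpha}(7n+r)+\frac{2\cdot 7^{\alpha}+1}{3}\right)\equiv 0\pmod 2$ for $r\in\{3,4,6\}$; (v) if $p>3$ is a prime with Legendre symbol $\left(\frac{ -7}{p}\right)=-1$, then for all $n\ge0$, $\alpha\ge0$ and $r\in\{1,2,\dots,p-1\}$, $$A_7\!\left(2p^{2\alpha+1}(pn+r)+\frac{2p^{2\alpha+2}+1}{3}\right)\equiv 0\pmod 2.$$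
   Context: $(a;q)_\infty=\prod_{j\ge0}(1-aq^j)$ for $|q|<1$. -}

module Defs where

open import Data.Nat as ℕ using (ℕ; zero; suc; _<ᵇ_; _∸_)
open import Data.Integer as ℤ using (ℤ; +_; _-_; _*_)
open import Data.Integer.Divisibility using (_∣_)
open import Data.Bool using (if_then_else_)
open import Data.Product using (_×_; ∃)
open import Relation.Nullary using (¬_)

Series : Set
Series = ℕ → ℤ

one : Series
one zero    = + 1
one (suc _) = + 0

-- multiplication by (1 - q^e)
mulFactor : ℕ → Series → Series
mulFactor e c m = if m <ᵇ e then c m else (c m - c (m ∸ e))

prodSeries : ℕ → ℕ → Series
prodSeries k zero    = one
prodSeries k (suc i) =
  mulFactor (suc (2 ℕ.* i)) (mulFactor (k ℕ.* suc (2 ℕ.* i)) (prodSeries k i))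

-- A_k(n) = coefficient of q^n in (q;q^2)_∞ (q^k;q^(2k))_∞  (k ≥ 1).
-- All omitted factors (i ≥ n) have exponent ≥ 2n+1 > n, so the truncated
-- product prodSeries k n has the exact n-th coefficient.
A : ℕ → ℕ → ℤ
A k n = prodSeries k n n

LegendreMinusOne : ℤ → ℕ → Set
LegendreMinusOne a p = ¬ (+ p ∣ a) × ¬ (∃ λ (x : ℤ) → + p ∣ (x * x - a))

{-# OPTIONS --safe #-}

-- Modulo 2, ∑ A₇(2n+1) qⁿ ≡ F := f₁ f₇, where f_k = (q^k; q^k)_∞.
--
-- By the pentagonal number theorem the coefficient of qⁿ in F has the parity of the number
-- of pairs (x, y) of odd integers up to signs with x² + 7 y² = 8 N, N = 3 n + 1.  In terms of
-- the norm form of ℤ[(1 + √-7)/2], where 2 splits, that number does not change when N is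
-- doubled, and for odd N complex conjugation pairs off the solutions unless N is a square or
-- 7 times a square.  Hence the coefficients c(n) of F satisfy c(4n+1) ≡ c(n), c(4n+3) ≡ 0 and
-- c(8n+4) ≡ c(8n+6) ≡ 0.  The first two say that the odd part of F is F(q²) ≡ F²; since the
-- generating function D of A₇ satisfies D F(q²) ≡ F, taking odd parts and cancelling F
-- identifies the odd part of D with F.  In (iv) and (v) the form does not represent 8 N at all.
module Submission where

open import Defs
open import Algebra.Bundles using (CommutativeRing)
open import Algebra.Properties.CommutativeSemigroup using (interchange)
open import Data.Bool using (Bool; true; false; not; _xor_; if_then_else_)
open import Data.Bool.Properties using (xor-comm; xor-assoc; xor-same; xor-identityʳ; xor-annihilates-not; xor-∧-commutativeRing; not-involutive)
open import Data.Empty using (⊥-elim)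
open import Data.Fin using (Fin; zero; suc; toℕ; fromℕ<)
open import Data.Fin.Properties using (all?; toℕ-fromℕ<)
open import Data.Integer as ℤ using (ℤ; +_; -[1+_]; ∣_∣; -_) renaming (_+_ to _+ᶻ_; _*_ to _*ᶻ_; _-_ to _-ᶻ_)
import Data.Integer.DivMod as ℤ
open import Data.Integer.Divisibility using (_∣_)
import Data.Integer.Properties as ℤ
open import Data.Integer.Tactic.RingSolver using (solve-∀)
open import Data.List using (List; []; _∷_; length; filter; cartesianProduct; _++_; map)
open import Data.List.Membership.Propositional using (_∈_)
open import Data.List.Membership.Propositional.Properties using (∈-∃++; ∈-filter⁺; ∈-filter⁻; ∈-cartesianProduct⁺)
open import Data.List.Relation.Binary.Permutation.Propositional using (_↭_; ↭-sym; ↭⇒↭ₛ)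
open import Data.List.Relation.Binary.Permutation.Propositional.Properties using (∈-resp-↭; ↭-length) renaming (shift to ↭-shift)
import Data.List.Relation.Binary.Permutation.Setoid.Properties as Permutation
open import Data.List.Relation.Unary.All as All using ([]; _∷_)
open import Data.List.Relation.Unary.AllPairs using ([]; _∷_)
open import Data.List.Relation.Unary.Any using (here; there)
open import Data.List.Relation.Unary.Unique.Propositional using (Unique)
import Data.List.Relation.Unary.Unique.Propositional.Properties as Unique
open import Data.Nat using (ℕ; zero; suc; _+_; _*_; _∸_; _^_; _/_; _%_; _≤_; _<_; _>_; z≤n; s≤s; _<ᵇ_; _≡ᵇ_; NonZero; >-nonZero)
open import Data.Nat.Coprimality using (Coprime; coprime-Bézout)
open import Data.Nat.DivMod using (%-distribˡ-*; [m+kn]%n≡m%n; m%n<n; m*n/n≡m; m≡m%n+[m/n]*n)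
import Data.Nat.Divisibility as ℕ
open import Data.Nat.GCD using (module Bézout)
open import Data.Nat.Primality using (Prime; prime?; euclidsLemma; prime⇒irreducible; prime⇒nonZero)
import Data.Nat.Properties as ℕ
import Data.Nat.Tactic.RingSolver as ℕ
open import Data.Product using (_×_; _,_; ∃; proj₁; proj₂)
open import Data.Sum using (_⊎_; inj₁; inj₂)
open import Relation.Binary.PropositionalEquality
open import Relation.Nullary using (¬_; yes; no; does)
open import Relation.Nullary.Decidable using (False; True; toWitness; toWitnessFalse; ¬?; from-yes)
open import Relation.Unary using (Decidable)
open ≡-Reasoning

-- Put ω = (1 + √-7)/2, of norm 2, and z = (x + y √-7)/2, of norm 2 N. For odd x and y exactly one
-- of ω and its conjugate divides z. Taking x and y in 1 + 4 ℤ fixes the signs and also settles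
-- which one: z = (x - y)/2 + y ω with (x - y)/2 even, so it is always ω. Dividing by ω therefore
-- matches the solutions for 2 N with those for N. For odd N the cofactor of ω has odd norm, so it
-- lies in ℤ[√-7] and equals some u + v √-7. Conjugating x + y √-7 itself would only change signs
-- that are already identified; the pairing conjugates the cofactor alone, and its fixed points have
-- v = 0 or u = 0. The other constraint is truncation: `A` is a coefficient of a finite product
-- whose length depends on the coefficient, so every identity of series is stated for finite
-- products or only up to a degree.

parity : ℕ → Bool
parity zero    = false
parity (suc n) = not (parity n)

-- Power series modulo 2

BSeries : Set
BSeries = ℕ → Bool

oneᵇ : BSeries
oneᵇ zero    = true
oneᵇ (suc _) = false

infixl 6 _⊕_
_⊕_ : BSeries → BSeries → BSeries
(c ⊕ d) m = c m xor d m

infix 4 _≈[_]_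
-- Truncations of two infinite products agree only in low degrees, so a degree bound accompanies
-- each comparison that involves the pentagonal number theorem.
_≈[_]_ : BSeries → ℕ → BSeries → Set
c ≈[ N ] d = ∀ m → m ≤ N → c m ≡ d m

shift : ℕ → BSeries → BSeries
shift zero    c m       = c m
shift (suc e) c zero    = false
shift (suc e) c (suc m) = shift e c m

-- Multiplication by 1 - q^e, whose sign is invisible modulo 2. Products are composites of such
-- operators applied to a series, so convolution of series never occurs.
mul : ℕ → BSeries → BSeries
mul e c = c ⊕ shift e c

xor-interchange : ∀ a b c d → (a xor b) xor (c xor d) ≡ (a xor c) xor (b xor d)
xor-interchange = interchange (CommutativeRing.+-commutativeSemigroup xor-∧-commutativeRing)

xor-cancelˡ : ∀ a b → a xor (a xor b) ≡ b
xor-cancelˡ true  true  = refl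
xor-cancelˡ true  false = refl
xor-cancelˡ false b     = refl

xor-injectiveʳ : ∀ a {b c} → b xor a ≡ c xor a → b ≡ c
xor-injectiveʳ a {b} {c} eq = begin
  b               ≡⟨ xor-cancelˡ a b ⟨
  a xor (a xor b) ≡⟨ cong (a xor_) (trans (xor-comm a b) (trans eq (xor-comm c a))) ⟩
  a xor (a xor c) ≡⟨ xor-cancelˡ a c ⟩
  c               ∎

shift-cong≤ : ∀ e {c d N} → c ≈[ N ] d → shift e c ≈[ N ] shift e d
shift-cong≤ zero    eq m       m≤N = eq m m≤N
shift-cong≤ (suc e) eq zero    m≤N = refl
shift-cong≤ (suc e) eq (suc m) m≤N = shift-cong≤ e eq m (ℕ.≤-trans (ℕ.n≤1+n m) m≤N)

≗⇒≈ : ∀ {c d : BSeries} {N} → c ≗ d → c ≈[ N ] d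
≗⇒≈ eq m _ = eq m

shift-cong : ∀ e {c d} → c ≗ d → shift e c ≗ shift e d
shift-cong e eq m = shift-cong≤ e (≗⇒≈ {N = m} eq) m ℕ.≤-refl

shift-⊕ : ∀ e c d → shift e (c ⊕ d) ≗ shift e c ⊕ shift e d
shift-⊕ zero    c d m       = refl
shift-⊕ (suc e) c d zero    = refl
shift-⊕ (suc e) c d (suc m) = shift-⊕ e c d m

shift-+ : ∀ e f c → shift (e + f) c ≗ shift e (shift f c)
shift-+ zero    f c m       = refl
shift-+ (suc e) f c zero    = refl
shift-+ (suc e) f c (suc m) = shift-+ e f c m

shift-≡ : ∀ {e f} c → e ≡ f → shift e c ≗ shift f c
shift-≡ c refl m = refl

shift-comm : ∀ e f c → shift e (shift f c) ≗ shift f (shift e c)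
shift-comm e f c m = begin
  shift e (shift f c) m ≡⟨ shift-+ e f c m ⟨
  shift (e + f) c m     ≡⟨ shift-≡ c (ℕ.+-comm e f) m ⟩
  shift (f + e) c m     ≡⟨ shift-+ f e c m ⟩
  shift f (shift e c) m ∎

shift-below : ∀ e c m → m < e → shift e c m ≡ false
shift-below (suc e) c zero    m<e       = refl
shift-below (suc e) c (suc m) (s≤s m<e) = shift-below e c m m<e

shift-one : ∀ e m → shift e oneᵇ m ≡ (e ≡ᵇ m)
shift-one zero    zero    = refl
shift-one zero    (suc m) = refl
shift-one (suc e) zero    = refl
shift-one (suc e) (suc m) = shift-one e m

mul-cong≤ : ∀ e {c d N} → c ≈[ N ] d → mul e c ≈[ N ] mul e d
mul-cong≤ e eq m m≤N = cong₂ _xor_ (eq m m≤N) (shift-cong≤ e eq m m≤N)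

mul-cong : ∀ e {c d} → c ≗ d → mul e c ≗ mul e d
mul-cong e eq m = cong₂ _xor_ (eq m) (shift-cong e eq m)

mul-≡ : ∀ {e f} c → e ≡ f → mul e c ≗ mul f c
mul-≡ c refl m = refl

mul-⊕ : ∀ e c d → mul e (c ⊕ d) ≗ mul e c ⊕ mul e d
mul-⊕ e c d m = trans (cong ((c m xor d m) xor_) (shift-⊕ e c d m))
                      (xor-interchange (c m) (d m) (shift e c m) (shift e d m))

mul-shift : ∀ e k c → mul e (shift k c) ≗ shift k (mul e c)
mul-shift e k c m = trans (cong (shift k c m xor_) (shift-comm e k c m))
                          (sym (shift-⊕ k c (shift e c) m))

mul-comm : ∀ e f c → mul e (mul f c) ≗ mul f (mul e c)
mul-comm e f c m = trans (mul-⊕ e c (shift f c) m) (cong (mul e c m xor_) (mul-shift e f c m))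

-- Frobenius in characteristic 2: the two middle terms of the square cancel. This is the source of
-- F² ≡ F(q²).
mul-square : ∀ e c → mul e (mul e c) ≗ mul (e + e) c
mul-square e c m = begin
  mul e c m xor shift e (mul e c) m
    ≡⟨ cong (mul e c m xor_) (shift-⊕ e c (shift e c) m) ⟩
  (c m xor shift e c m) xor (shift e c m xor shift e (shift e c) m)
    ≡⟨ xor-assoc (c m) (shift e c m) _ ⟩
  c m xor (shift e c m xor (shift e c m xor shift e (shift e c) m))
    ≡⟨ cong (c m xor_) (xor-cancelˡ (shift e c m) _) ⟩
  c m xor shift e (shift e c) m
    ≡⟨ cong (c m xor_) (shift-+ e e c m) ⟨
  mul (e + e) c m ∎

shift-suc-local : ∀ e {c d} m → (∀ i → i < m → c i ≡ d i) → shift (suc e) c m ≡ shift (suc e) d m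
shift-suc-local e       zero    eq = refl
shift-suc-local e {c} {d} (suc m) eq = shift-cong≤ e {c} {d} (λ i i≤m → eq i (s≤s i≤m)) m ℕ.≤-refl

-- As e > 0, the coefficient of `mul e c` at m is `c m` plus an earlier coefficient of `c`, so `c`
-- is recovered degree by degree. This takes the place of dividing by F.
mul-injective : ∀ e {c d N} → 0 < e → mul e c ≈[ N ] mul e d → c ≈[ N ] d
mul-injective (suc e) {c} {d} {N} _ eq m m≤N = go (suc m) m ℕ.≤-refl m≤N
  where
  -- The bound `k` makes the strong induction on `m` structural.
  go : ∀ k m → m < k → m ≤ N → c m ≡ d m
  go (suc k) m (s≤s m≤k) m≤N = xor-injectiveʳ (shift (suc e) c m)
    (trans (eq m m≤N) (cong (d m xor_) (sym (shift-suc-local e {c} {d} m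
      λ i i<m → go k i (ℕ.≤-trans i<m m≤k) (ℕ.≤-trans (ℕ.<⇒≤ i<m) m≤N)))))

-- Finite products over an arithmetic progression of exponents

multiples : ℕ → ℕ → BSeries → BSeries
multiples e zero    c = c
multiples e (suc n) c = mul (e * suc n) (multiples e n c)

oddMultiples : ℕ → ℕ → BSeries → BSeries
oddMultiples e zero    c = c
oddMultiples e (suc n) c = mul (e * suc (2 * n)) (oddMultiples e n c)

multiples-cong≤ : ∀ e n {c d N} → c ≈[ N ] d → multiples e n c ≈[ N ] multiples e n d
multiples-cong≤ e zero    eq = eq
multiples-cong≤ e (suc n) eq = mul-cong≤ (e * suc n) (multiples-cong≤ e n eq)

multiples-cong : ∀ e n {c d} → c ≗ d → multiples e n c ≗ multiples e n d
multiples-cong e n eq m = multiples-cong≤ e n (≗⇒≈ {N = m} eq) m ℕ.≤-refl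

multiples-injective : ∀ e n {c d N} → 0 < e → multiples e n c ≈[ N ] multiples e n d → c ≈[ N ] d
multiples-injective e zero    0<e eq = eq
multiples-injective e (suc n) 0<e eq =
  multiples-injective e n 0<e (mul-injective (e * suc n) (ℕ.*-mono-≤ 0<e (s≤s z≤n)) eq)

multiples-mul : ∀ e n f c → multiples e n (mul f c) ≗ mul f (multiples e n c)
multiples-mul e zero    f c m = refl
multiples-mul e (suc n) f c m = trans (mul-cong (e * suc n) (multiples-mul e n f c) m)
                                      (mul-comm (e * suc n) f (multiples e n c) m)

multiples-shift : ∀ e n k c → multiples e n (shift k c) ≗ shift k (multiples e n c)
multiples-shift e zero    k c m = refl
multiples-shift e (suc n) k c m = trans (mul-cong (e * suc n) (multiples-shift e n k c) m)
                                        (mul-shift (e * suc n) k (multiples e n c) m)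

multiples-⊕ : ∀ e n c d → multiples e n (c ⊕ d) ≗ multiples e n c ⊕ multiples e n d
multiples-⊕ e zero    c d m = refl
multiples-⊕ e (suc n) c d m = trans (mul-cong (e * suc n) (multiples-⊕ e n c d) m)
                                    (mul-⊕ (e * suc n) (multiples e n c) (multiples e n d) m)

multiples-comm : ∀ e n f k c → multiples e n (multiples f k c) ≗ multiples f k (multiples e n c)
multiples-comm e zero    f k c m = refl
multiples-comm e (suc n) f k c m = trans (mul-cong (e * suc n) (multiples-comm e n f k c) m)
                                         (sym (multiples-mul f k (e * suc n) (multiples e n c) m))

multiples-square : ∀ e n c → multiples e n (multiples e n c) ≗ multiples (2 * e) n c
multiples-square e zero    c m = refl
multiples-square e (suc n) c m = begin
  mul k (multiples e n (mul k (multiples e n c))) m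
    ≡⟨ mul-cong k (multiples-mul e n k (multiples e n c)) m ⟩
  mul k (mul k (multiples e n (multiples e n c))) m
    ≡⟨ mul-square k (multiples e n (multiples e n c)) m ⟩
  mul (k + k) (multiples e n (multiples e n c)) m
    ≡⟨ mul-cong (k + k) (multiples-square e n c) m ⟩
  mul (k + k) (multiples (2 * e) n c) m
    ≡⟨ mul-≡ (multiples (2 * e) n c) (eq e n) m ⟩
  multiples (2 * e) (suc n) c m ∎
  where
  k = e * suc n
  eq : ∀ e n → e * suc n + e * suc n ≡ 2 * e * suc n
  eq = ℕ.solve-∀

multiples-split : ∀ e n c → multiples e (2 * n) c ≗ multiples (2 * e) n (oddMultiples e n c)
multiples-split e zero    c m = refl
multiples-split e (suc n) c m = begin
  multiples e (2 * suc n) c m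
    ≡⟨ cong (λ k → multiples e k c m) (2*suc n) ⟩
  mul (e * suc (suc (2 * n))) (mul k (multiples e (2 * n) c)) m
    ≡⟨ mul-≡ (mul k (multiples e (2 * n) c)) (eq e n) m ⟩
  mul k′ (mul k (multiples e (2 * n) c)) m
    ≡⟨ mul-cong k′ (mul-cong k (multiples-split e n c)) m ⟩
  mul k′ (mul k (multiples (2 * e) n (oddMultiples e n c))) m
    ≡⟨ mul-cong k′ (multiples-mul (2 * e) n k (oddMultiples e n c)) m ⟨
  multiples (2 * e) (suc n) (oddMultiples e (suc n) c) m ∎
  where
  k = e * suc (2 * n)
  k′ = 2 * e * suc n
  2*suc : ∀ n → 2 * suc n ≡ suc (suc (2 * n))
  2*suc = ℕ.solve-∀
  eq : ∀ e n → e * suc (suc (2 * n)) ≡ 2 * e * suc n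
  eq = ℕ.solve-∀

-- Bisection

evenPart oddPart : BSeries → BSeries
evenPart c m = c (2 * m)
oddPart  c m = c (suc (2 * m))

shift-evenPart : ∀ e c m → shift (2 * e) c (2 * m) ≡ shift e (evenPart c) m
shift-evenPart zero    c m       = refl
shift-evenPart (suc e) c zero    = refl
shift-evenPart (suc e) c (suc m) rewrite ℕ.+-suc e (e + 0) | ℕ.+-suc m (m + 0) = shift-evenPart e c m

shift-oddPart : ∀ e c m → shift (2 * e) c (suc (2 * m)) ≡ shift e (oddPart c) m
shift-oddPart zero    c m       = refl
shift-oddPart (suc e) c zero    rewrite ℕ.+-suc e (e + 0) = refl
shift-oddPart (suc e) c (suc m) rewrite ℕ.+-suc e (e + 0) | ℕ.+-suc m (m + 0) = shift-oddPart e c m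

-- A factor 1 - q^(2k) preserves the parity of exponents, so it acts on each half of a series
-- separately, and there as 1 - q^k.
evenPart-multiples : ∀ e n c → evenPart (multiples (2 * e) n c) ≗ multiples e n (evenPart c)
evenPart-multiples e zero    c m = refl
evenPart-multiples e (suc n) c m = begin
  mul (2 * e * suc n) d (2 * m)   ≡⟨ mul-≡ d (ℕ.*-assoc 2 e (suc n)) (2 * m) ⟩
  mul (2 * (e * suc n)) d (2 * m) ≡⟨ cong (d (2 * m) xor_) (shift-evenPart (e * suc n) d m) ⟩
  mul (e * suc n) (evenPart d) m  ≡⟨ mul-cong (e * suc n) (evenPart-multiples e n c) m ⟩
  multiples e (suc n) (evenPart c) m ∎
  where d = multiples (2 * e) n c

oddPart-multiples : ∀ e n c → oddPart (multiples (2 * e) n c) ≗ multiples e n (oddPart c)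
oddPart-multiples e zero    c m = refl
oddPart-multiples e (suc n) c m = begin
  mul (2 * e * suc n) d (suc (2 * m))   ≡⟨ mul-≡ d (ℕ.*-assoc 2 e (suc n)) (suc (2 * m)) ⟩
  mul (2 * (e * suc n)) d (suc (2 * m)) ≡⟨ cong (d (suc (2 * m)) xor_) (shift-oddPart (e * suc n) d m) ⟩
  mul (e * suc n) (oddPart d) m         ≡⟨ mul-cong (e * suc n) (oddPart-multiples e n c) m ⟩
  multiples e (suc n) (oddPart c) m ∎
  where d = multiples (2 * e) n c

zeroᵇ : BSeries
zeroᵇ _ = false

shift-zero : ∀ e m → shift e zeroᵇ m ≡ false
shift-zero zero    m       = refl
shift-zero (suc e) zero    = refl
shift-zero (suc e) (suc m) = shift-zero e m

multiples-zero : ∀ e n → multiples e n zeroᵇ ≗ zeroᵇ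
multiples-zero e zero    m = refl
multiples-zero e (suc n) m = trans (mul-cong (e * suc n) (multiples-zero e n) m)
                                   (shift-zero (e * suc n) m)

evenPart-one : evenPart oneᵇ ≗ oneᵇ
evenPart-one zero    = refl
evenPart-one (suc m) = refl

-- Shanks' finite form of the pentagonal number theorem

triangle : ℕ → ℕ
triangle zero    = 0
triangle (suc n) = suc n + triangle n

-- pent a = a (3 a + 1) / 2
pent : ℤ → ℕ
pent (+ n)    = n * n + triangle n
pent -[1+ n ] = suc n * suc n + triangle n

ball : ℕ → List ℤ
ball zero    = + 0 ∷ []
ball (suc n) = + suc n ∷ -[1+ n ] ∷ ball n

∑ : ∀ {X : Set} → (X → BSeries) → List X → BSeries
∑ f []       = zeroᵇ
∑ f (x ∷ xs) = f x ⊕ ∑ f xs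

-- With P n = ∏_{j ≤ n} (1 - q^(e j)), quotient e s d is P (s + d) / P s and
-- partialSum e s d is Σ_{i ≤ s} q^(e (n i + i (i+1)/2)) P n / P i for n = s + d.
quotient : ℕ → ℕ → ℕ → BSeries
quotient e s zero    = oneᵇ
quotient e s (suc d) = mul (e * (s + suc d)) (quotient e s d)

summand : ℕ → ℕ → ℕ → BSeries
summand e s d = shift (e * ((s + d) * s + triangle s)) (quotient e s d)

partialSum : ℕ → ℕ → ℕ → BSeries
partialSum e zero    d = quotient e 0 d
partialSum e (suc s) d = partialSum e s (suc d) ⊕ summand e (suc s) d

quotient-multiples : ∀ e n → quotient e 0 n ≗ multiples e n oneᵇ
quotient-multiples e zero    m = refl
quotient-multiples e (suc n) m = mul-cong (e * suc n) (quotient-multiples e n) m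

quotient-suc : ∀ e s d → quotient e s (suc d) ≗ mul (e * suc s) (quotient e (suc s) d)
quotient-suc e s zero    m = mul-≡ oneᵇ (cong (e *_) (ℕ.+-comm s 1)) m
quotient-suc e s (suc d) m = begin
  mul k (quotient e s (suc d)) m                    ≡⟨ mul-cong k (quotient-suc e s d) m ⟩
  mul k (mul (e * suc s) (quotient e (suc s) d)) m  ≡⟨ mul-comm k (e * suc s) (quotient e (suc s) d) m ⟩
  mul (e * suc s) (mul k (quotient e (suc s) d)) m
    ≡⟨ mul-cong (e * suc s) (mul-≡ (quotient e (suc s) d) (cong (e *_) (ℕ.+-suc s (suc d)))) m ⟩
  mul (e * suc s) (quotient e (suc s) (suc d)) m ∎
  where k = e * (s + suc (suc d))

shift-mul : ∀ j e c → shift j (mul e c) ≗ shift j c ⊕ shift (j + e) c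
shift-mul j e c m = trans (shift-⊕ j c (shift e c) m) (cong (shift j c m xor_) (sym (shift-+ j e c m)))

telescope : ∀ a b x y z → a xor b ≡ x xor y → (a xor (y xor z)) xor (b xor x) ≡ z
telescope a b x y z eq = begin
  (a xor (y xor z)) xor (b xor x)   ≡⟨ xor-interchange a (y xor z) b x ⟩
  (a xor b) xor ((y xor z) xor x)   ≡⟨ cong₂ _xor_ eq (xor-comm (y xor z) x) ⟩
  (x xor y) xor (x xor (y xor z))   ≡⟨ cong ((x xor y) xor_) (xor-assoc x y z) ⟨
  (x xor y) xor ((x xor y) xor z)   ≡⟨ xor-cancelˡ (x xor y) z ⟩
  z ∎

-- Shanks' telescoping, by induction on s. In the inductive step the last factor of the quotient
-- splits the new summand into the exponents Y and Z, and the first factor splits the induction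
-- hypothesis into X and X + e (s + 1) = Y. The old summand has exponent X, so X and Y cancel in
-- pairs and Z remains.
partialSum-step : ∀ e s d → partialSum e s (suc d) ⊕ partialSum e s d
                          ≗ shift (e * ((s + suc d) * suc s + triangle s)) (quotient e s d)
partialSum-step e zero    d m = begin
  mul (e * suc d) v m xor v m         ≡⟨ xor-comm (mul (e * suc d) v m) (v m) ⟩
  v m xor (v m xor shift (e * suc d) v m) ≡⟨ xor-cancelˡ (v m) _ ⟩
  shift (e * suc d) v m               ≡⟨ shift-≡ v (eq e d) m ⟩
  shift (e * (suc d * 1 + 0)) v m ∎
  where
  v = quotient e 0 d
  eq : ∀ e d → e * suc d ≡ e * (suc d * 1 + 0)
  eq = ℕ.solve-∀
partialSum-step e (suc s) d m = begin
  (a xor summand e (suc s) (suc d) m) xor (b xor summand e (suc s) d m)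
    ≡⟨ cong₂ (λ t u → (a xor t) xor (b xor u))
             (trans (shift-mul Y (e * (suc s + suc d)) v m)
                    (cong₂ _xor_ (shift-≡ v (eqY e s d (triangle s)) m)
                                 (shift-≡ v (eqZ e s d (triangle s)) m)))
             (shift-≡ v (eqX e s d (triangle s)) m) ⟩
  (a xor (shift (X + e * suc s) v m xor shift Z v m)) xor (b xor shift X v m)
    ≡⟨ telescope a b (shift X v m) (shift (X + e * suc s) v m) (shift Z v m) step ⟩
  shift Z v m ∎
  where
  v = quotient e (suc s) d
  a = partialSum e s (suc (suc d)) m
  b = partialSum e s (suc d) m
  X = e * ((s + suc (suc d)) * suc s + triangle s)
  Y = e * ((suc s + suc d) * suc s + triangle (suc s))
  Z = e * ((suc s + suc d) * suc (suc s) + triangle (suc s))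
  eqX : ∀ e s d t → e * ((suc s + d) * suc s + (suc s + t)) ≡ e * ((s + suc (suc d)) * suc s + t)
  eqX = ℕ.solve-∀
  eqY : ∀ e s d t → e * ((suc s + suc d) * suc s + (suc s + t))
                  ≡ e * ((s + suc (suc d)) * suc s + t) + e * suc s
  eqY = ℕ.solve-∀
  eqZ : ∀ e s d t → e * ((suc s + suc d) * suc s + (suc s + t)) + e * (suc s + suc d)
                  ≡ e * ((suc s + suc d) * suc (suc s) + (suc s + t))
  eqZ = ℕ.solve-∀
  step : a xor b ≡ shift X v m xor shift (X + e * suc s) v m
  step = trans (partialSum-step e s (suc d) m)
        (trans (shift-cong X (quotient-suc e s d) m) (shift-mul X (e * suc s) v m))

-- Going from n to n + 1 adds two terms: the top summand, whose quotient is empty, has the exponent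
-- for a = n + 1, and the change of the remaining summands, by `partialSum-step` with d = 0, has
-- that for a = -(n + 1).
shanks : ∀ e n → partialSum e n 0 ≗ ∑ (λ a → shift (e * pent a) oneᵇ) (ball n)
shanks e zero    m = sym (trans (xor-identityʳ _) (shift-≡ oneᵇ (ℕ.*-zeroʳ e) m))
shanks e (suc n) m = begin
  a xor summand e (suc n) 0 m
    ≡⟨ xor-comm a _ ⟩
  summand e (suc n) 0 m xor a
    ≡⟨ cong₂ _xor_ (shift-≡ oneᵇ (eq₁ e n (triangle n)) m) (sym (xor-cancelˡ b a)) ⟩
  shift (e * pent (+ suc n)) oneᵇ m xor (b xor (b xor a))
    ≡⟨ cong (shift (e * pent (+ suc n)) oneᵇ m xor_) (trans (cong (b xor_) (trans (xor-comm b a) step)) (xor-comm b _)) ⟩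
  shift (e * pent (+ suc n)) oneᵇ m xor (shift (e * pent -[1+ n ]) oneᵇ m xor b)
    ≡⟨ cong (λ t → shift (e * pent (+ suc n)) oneᵇ m xor (shift (e * pent -[1+ n ]) oneᵇ m xor t)) (shanks e n m) ⟩
  ∑ (λ a → shift (e * pent a) oneᵇ) (ball (suc n)) m ∎
  where
  a = partialSum e n 1 m
  b = partialSum e n 0 m
  eq₁ : ∀ e n t → e * ((suc n + 0) * suc n + (suc n + t)) ≡ e * (suc n * suc n + (suc n + t))
  eq₁ = ℕ.solve-∀
  eq₂ : ∀ e n t → e * ((n + 1) * suc n + t) ≡ e * (suc n * suc n + t)
  eq₂ = ℕ.solve-∀
  step : a xor b ≡ shift (e * pent -[1+ n ]) oneᵇ m
  step = trans (partialSum-step e n 0 m) (shift-≡ oneᵇ (eq₂ e n (triangle n)) m)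

-- With n = s + d, a summand with i ≥ 1 starts in degree e (n i + i (i + 1)/2) > n, so up to degree
-- n only the summand i = 0 is visible.
partialSum-low : ∀ e s d → 0 < e → partialSum e s d ≈[ s + d ] quotient e 0 (s + d)
partialSum-low e zero    d 0<e m m≤ = refl
partialSum-low e (suc s) d 0<e m m≤ = begin
  partialSum e s (suc d) m xor summand e (suc s) d m
    ≡⟨ cong (partialSum e s (suc d) m xor_) (shift-below (e * X) (quotient e (suc s) d) m big) ⟩
  partialSum e s (suc d) m xor false
    ≡⟨ xor-identityʳ _ ⟩
  partialSum e s (suc d) m
    ≡⟨ partialSum-low e s (suc d) 0<e m (subst (m ≤_) (sym (ℕ.+-suc s d)) m≤) ⟩
  quotient e 0 (s + suc d) m
    ≡⟨ cong (λ k → quotient e 0 k m) (ℕ.+-suc s d) ⟩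
  quotient e 0 (suc s + d) m ∎
  where
  X = (suc s + d) * suc s + triangle (suc s)
  eq : ∀ s d t → suc (suc s + d) + ((suc s + d) * s + (s + t)) ≡ (suc s + d) * suc s + (suc s + t)
  eq = ℕ.solve-∀
  big : m < e * X
  big = ℕ.≤-trans (s≤s m≤)
       (ℕ.≤-trans (subst (suc (suc s + d) ≤_) (eq s d (triangle s)) (ℕ.m≤m+n _ _))
       (subst (_≤ e * X) (ℕ.*-identityˡ X) (ℕ.*-monoˡ-≤ X 0<e)))

pentagonal : ∀ e n → 0 < e → multiples e n oneᵇ ≈[ n ] ∑ (λ a → shift (e * pent a) oneᵇ) (ball n)
pentagonal e n 0<e m m≤n = begin
  multiples e n oneᵇ m     ≡⟨ quotient-multiples e n m ⟨
  quotient e 0 n m         ≡⟨ cong (λ k → quotient e 0 k m) (ℕ.+-identityʳ n) ⟨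
  quotient e 0 (n + 0) m   ≡⟨ partialSum-low e n 0 0<e m (subst (m ≤_) (sym (ℕ.+-identityʳ n)) m≤n) ⟨
  partialSum e n 0 m       ≡⟨ shanks e n m ⟩
  ∑ (λ a → shift (e * pent a) oneᵇ) (ball n) m ∎

-- Counting by matchings and pairings

module _ {X : Set} where

  extract : ∀ {x : X} {xs} → x ∈ xs → ∃ λ xs′ → xs ↭ x ∷ xs′
  extract x∈xs with ys , zs , refl ← ∈-∃++ x∈xs = ys ++ zs , ↭-shift _ ys zs

  Unique-resp-↭ : ∀ {xs ys : List X} → xs ↭ ys → Unique xs → Unique ys
  Unique-resp-↭ p = Permutation.Unique-resp-↭ (setoid X) (↭⇒↭ₛ p)

  record Enumerates (xs : List X) (P : X → Set) : Set where
    field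
      unique   : Unique xs
      sound    : ∀ {x} → x ∈ xs → P x
      complete : ∀ {x} → P x → x ∈ xs

open Enumerates

-- Pigeonhole by induction on `xs`: the partner of the head is removed from `ys`, and injectivity
-- keeps the partners of the other entries away from it.
length-mono : ∀ {X Y : Set} (R : X → Y → Set) {xs : List X} {ys : List Y} → Unique xs →
              (∀ {x} → x ∈ xs → ∃ λ y → y ∈ ys × R x y) →
              (∀ {x x′ y y′} → R x y → R x′ y′ → y ≡ y′ → x ≡ x′) →
              length xs ≤ length ys
length-mono R {[]}     []         total inj = z≤n
length-mono R {x ∷ xs} {ys} (x∉ ∷ uniq) total inj with total (here refl)
... | y , y∈ys , Rxy with extract y∈ys
... | ys′ , p = subst (suc (length xs) ≤_) (sym (↭-length p)) (s≤s (length-mono R uniq total′ inj))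
  where
  total′ : ∀ {z} → z ∈ xs → ∃ λ w → w ∈ ys′ × R z w
  total′ z∈xs with total (there z∈xs)
  ... | w , w∈ys , Rzw with ∈-resp-↭ p w∈ys
  ...   | here w≡y    = ⊥-elim (All.lookup x∉ z∈xs (inj Rxy Rzw (sym w≡y)))
  ...   | there w∈ys′ = w , w∈ys′ , Rzw

-- A relation is used instead of a function because the correspondences below are given by
-- congruence cases and are defined only where a solution forces the right residue.
record Matching {X Y : Set} (P : X → Set) (Q : Y → Set) (R : X → Y → Set) : Set where
  field
    forth      : ∀ x → P x → ∃ λ y → Q y × R x y
    back       : ∀ y → Q y → ∃ λ x → P x × R x y
    functional : ∀ {x x′ y y′} → R x y → R x′ y′ → x ≡ x′ → y ≡ y′
    injective  : ∀ {x x′ y y′} → R x y → R x′ y′ → y ≡ y′ → x ≡ x′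

matching-length : ∀ {X Y : Set} {P : X → Set} {Q : Y → Set} {R xs ys} → Matching P Q R →
                  Enumerates xs P → Enumerates ys Q → length xs ≡ length ys
matching-length {R = R} M E F = ℕ.≤-antisym
  (length-mono R (unique E) (λ x∈ → let y , q , r = forth _ (sound E x∈) in y , complete F q , r) injective)
  (length-mono (λ y x → R x y) (unique F) (λ y∈ → let x , p , r = back _ (sound F y∈) in x , complete E p , r) functional)
  where open Matching M

record Pairing {X : Set} (P : X → Set) (R : X → X → Set) : Set where
  field
    partner     : ∀ x → P x → ∃ λ y → P y × R x y
    symmetric   : ∀ {x y} → R x y → R y x
    functional  : ∀ {x x′ y y′} → R x y → R x′ y′ → x ≡ x′ → y ≡ y′
    irreflexive : ∀ {x y} → P x → R x y → x ≢ y

-- The head and its partner are distinct and are removed together; symmetry and functionality keep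
-- the remaining list closed under the pairing. The argument `n` of `go` bounds the length, as the
-- list shrinks by two after a rearrangement.
pairing-even : ∀ {X : Set} {P : X → Set} {R xs} → Pairing P R → Enumerates xs P → parity (length xs) ≡ false
pairing-even {X} {P} {R} {xs} M E = go (length xs) xs ℕ.≤-refl (unique E) (sound E)
    (λ x∈ → let y , p , r = partner _ (sound E x∈) in y , complete E p , r)
  where
  open Pairing M
  go : ∀ n zs → length zs ≤ n → Unique zs → (∀ {x} → x ∈ zs → P x) →
       (∀ {x} → x ∈ zs → ∃ λ y → y ∈ zs × R x y) → parity (length zs) ≡ false
  go n       []       _         _             _   _     = refl
  go (suc n) (x ∷ zs) (s≤s len) (x∉ ∷ uniq) ok total with total (here refl)
  ... | y , here y≡x , Rxy = ⊥-elim (irreflexive (ok (here refl)) Rxy (sym y≡x))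
  ... | y , there y∈zs , Rxy with extract y∈zs
  ... | ys , p = trans (cong (λ k → not (parity k)) (↭-length p))
                (trans (not-involutive _)
                (go n ys (ℕ.≤-trans (ℕ.n≤1+n _) (subst (_≤ n) (↭-length p) len)) (tail uniq′)
                    (λ z∈ → ok (there (up z∈))) total′))
    where
    uniq′ = Unique-resp-↭ p uniq
    tail : ∀ {z : X} {zs} → Unique (z ∷ zs) → Unique zs
    tail (_ ∷ u) = u
    up : ∀ {z} → z ∈ ys → z ∈ zs
    up z∈ = ∈-resp-↭ (↭-sym p) (there z∈)
    y∉ : ∀ {z} → z ∈ ys → y ≢ z
    y∉ with z∉ ∷ _ ← uniq′ = All.lookup z∉
    total′ : ∀ {z} → z ∈ ys → ∃ λ w → w ∈ ys × R z w
    total′ z∈ with total (there (up z∈))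
    ... | w , here w≡x , Rzw = ⊥-elim (y∉ z∈ (functional Rxy (symmetric Rzw) (sym w≡x)))
    ... | w , there w∈ , Rzw with ∈-resp-↭ p w∈
    ...   | here w≡y  = ⊥-elim (All.lookup x∉ (up z∈) (functional (symmetric Rxy) (symmetric Rzw) (sym w≡y)))
    ...   | there w∈′ = w , w∈′ , Rzw

-- Linear relations and remainders in ℤ

cancel : ∀ k .{{_ : NonZero k}} {x y} → + k *ᶻ (x -ᶻ y) ≡ + 0 → x ≡ y
cancel (suc k) {x} {y} eq with ℤ.i*j≡0⇒i≡0∨j≡0 (+ suc k) eq
... | inj₂ x-y≡0 = ℤ.i-j≡0⇒i≡j x y x-y≡0

indivisible : ∀ k r z {_ : False (k ℕ.∣? r)} → + k *ᶻ z -ᶻ + r ≢ + 0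
indivisible k r z {k∤r} eq = toWitnessFalse k∤r (ℕ.divides ∣ z ∣ (begin
  r             ≡⟨ cong ∣_∣ (ℤ.i-j≡0⇒i≡j (+ k *ᶻ z) (+ r) eq) ⟨
  ∣ + k *ᶻ z ∣  ≡⟨ ℤ.abs-* (+ k) z ⟩
  k * ∣ z ∣     ≡⟨ ℕ.*-comm k ∣ z ∣ ⟩
  ∣ z ∣ * k     ∎))

-- Linear reasoning by certificate: once the multipliers α and β are named, what is left is a
-- polynomial identity for the ring solver.
combine : ∀ {p q r s t} α β → p ≡ q → r ≡ s → t ≡ α *ᶻ (p -ᶻ q) +ᶻ β *ᶻ (r -ᶻ s) → t ≡ + 0
combine {p} {r = r} α β refl refl eq = trans eq
  (trans (cong₂ (λ u v → α *ᶻ u +ᶻ β *ᶻ v) (ℤ.+-inverseʳ p) (ℤ.+-inverseʳ r))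
         (cong₂ _+ᶻ_ (ℤ.*-zeroʳ α) (ℤ.*-zeroʳ β)))

scale : ∀ {p q t} α → p ≡ q → t ≡ α *ᶻ (p -ᶻ q) → t ≡ + 0
scale {p} α refl eq = trans eq (trans (cong (α *ᶻ_) (ℤ.+-inverseʳ p)) (ℤ.*-zeroʳ α))

remainder : ∀ k .{{_ : NonZero k}} z → ∃ λ (r : Fin k) → ∃ λ c → z ≡ + k *ᶻ c +ᶻ + toℕ r
remainder k z = fromℕ< r<k , z ℤ./ℕ k , (begin
  z                                    ≡⟨ ℤ.a≡a%ℕn+[a/ℕn]*n z k ⟩
  + (z ℤ.%ℕ k) +ᶻ (z ℤ./ℕ k) *ᶻ + k    ≡⟨ ℤ.+-comm (+ (z ℤ.%ℕ k)) ((z ℤ./ℕ k) *ᶻ + k) ⟩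
  (z ℤ./ℕ k) *ᶻ + k +ᶻ + (z ℤ.%ℕ k)    ≡⟨ cong₂ _+ᶻ_ (ℤ.*-comm (z ℤ./ℕ k) (+ k)) (cong +_ (sym (toℕ-fromℕ< r<k))) ⟩
  + k *ᶻ (z ℤ./ℕ k) +ᶻ + toℕ (fromℕ< r<k) ∎)
  where r<k = ℤ.n%ℕd<d z k

-- The form x² + 7 y²

form : ℤ → ℤ → ℤ
form x y = x *ᶻ x +ᶻ + 7 *ᶻ (y *ᶻ y)

-- Normal forms up to sign: of ± an odd integer exactly one lies in 1 + 4 ℤ, and of ± an integer
-- prime to 6 exactly one lies in 1 + 6 ℤ. Thus solutions in `a` and `b` count pairs up to signs.
six four : ℤ → ℤ
six  a = + 6 *ᶻ a +ᶻ + 1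
four a = + 4 *ᶻ a +ᶻ + 1

Six Four : ℤ → ℤ × ℤ → Set
Six  N (a , b) = form (six a) (six b) ≡ + 8 *ᶻ N
Four N (a , b) = form (four a) (four b) ≡ + 8 *ᶻ N

-- Multiplication of x + y √-7 by (±1 ± √-7) / 4, with signs chosen to stay in 1 + 4 ℤ.
data Halve : ℤ × ℤ → ℤ × ℤ → Set where
  halve₁ : ∀ b c {a a′ b′} → a ≡ b +ᶻ + 4 *ᶻ c +ᶻ + 1 →
           a′ ≡ - (+ 2 *ᶻ b) -ᶻ c -ᶻ + 1 → b′ ≡ c → Halve (a , b) (a′ , b′)
  halve₃ : ∀ b c {a a′ b′} → a ≡ b +ᶻ + 4 *ᶻ c +ᶻ + 3 →
           a′ ≡ + 2 *ᶻ b +ᶻ c +ᶻ + 1 → b′ ≡ - c -ᶻ + 1 → Halve (a , b) (a′ , b′)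

halve-disjoint : ∀ b c c′ → b +ᶻ + 4 *ᶻ c +ᶻ + 1 ≢ b +ᶻ + 4 *ᶻ c′ +ᶻ + 3
halve-disjoint b c c′ p = indivisible 4 2 (c -ᶻ c′) (scale (+ 1) p (eq b c c′))
  where
  eq : ∀ b c c′ → + 4 *ᶻ (c -ᶻ c′) -ᶻ + 2 ≡ + 1 *ᶻ ((b +ᶻ + 4 *ᶻ c +ᶻ + 1) -ᶻ (b +ᶻ + 4 *ᶻ c′ +ᶻ + 3))
  eq = solve-∀

halve-disjoint′ : ∀ b b′ c c′ → - (+ 2 *ᶻ b) -ᶻ c -ᶻ + 1 ≡ + 2 *ᶻ b′ +ᶻ c′ +ᶻ + 1 → c ≢ - c′ -ᶻ + 1
halve-disjoint′ b b′ c c′ p r = indivisible 2 1 (- b -ᶻ b′) (combine (+ 1) (+ 1) p r (eq b b′ c c′))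
  where
  eq : ∀ b b′ c c′ → + 2 *ᶻ (- b -ᶻ b′) -ᶻ + 1
     ≡ + 1 *ᶻ ((- (+ 2 *ᶻ b) -ᶻ c -ᶻ + 1) -ᶻ (+ 2 *ᶻ b′ +ᶻ c′ +ᶻ + 1)) +ᶻ + 1 *ᶻ (c -ᶻ (- c′ -ᶻ + 1))
  eq = solve-∀

halve-functional : ∀ {x x′ y y′} → Halve x y → Halve x′ y′ → x ≡ x′ → y ≡ y′
halve-functional (halve₁ b c p refl refl) (halve₁ _ c′ q refl refl) refl =
  cong (λ c → - (+ 2 *ᶻ b) -ᶻ c -ᶻ + 1 , c)
    (cancel 4 (scale (+ 1) (trans (sym p) q) (eq b c c′)))
  where
  eq : ∀ b c c′ → + 4 *ᶻ (c -ᶻ c′) ≡ + 1 *ᶻ ((b +ᶻ + 4 *ᶻ c +ᶻ + 1) -ᶻ (b +ᶻ + 4 *ᶻ c′ +ᶻ + 1))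
  eq = solve-∀
halve-functional (halve₃ b c p refl refl) (halve₃ _ c′ q refl refl) refl =
  cong (λ c → + 2 *ᶻ b +ᶻ c +ᶻ + 1 , - c -ᶻ + 1)
    (cancel 4 (scale (+ 1) (trans (sym p) q) (eq b c c′)))
  where
  eq : ∀ b c c′ → + 4 *ᶻ (c -ᶻ c′) ≡ + 1 *ᶻ ((b +ᶻ + 4 *ᶻ c +ᶻ + 3) -ᶻ (b +ᶻ + 4 *ᶻ c′ +ᶻ + 3))
  eq = solve-∀
halve-functional (halve₁ b c p refl refl) (halve₃ _ c′ q refl refl) refl =
  ⊥-elim (halve-disjoint b c c′ (trans (sym p) q))
halve-functional (halve₃ b c p refl refl) (halve₁ _ c′ q refl refl) refl =
  ⊥-elim (halve-disjoint b c′ c (trans (sym q) p))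

halve-injective : ∀ {x x′ y y′} → Halve x y → Halve x′ y′ → y ≡ y′ → x ≡ x′
halve-injective (halve₁ b c refl p refl) (halve₁ b′ _ refl q refl) refl =
  cong (λ b → b +ᶻ + 4 *ᶻ c +ᶻ + 1 , b)
    (cancel 2 (scale (- (+ 1)) (trans (sym p) q) (eq b b′ c)))
  where
  eq : ∀ b b′ c → + 2 *ᶻ (b -ᶻ b′) ≡ - (+ 1) *ᶻ ((- (+ 2 *ᶻ b) -ᶻ c -ᶻ + 1) -ᶻ (- (+ 2 *ᶻ b′) -ᶻ c -ᶻ + 1))
  eq = solve-∀
halve-injective (halve₃ b c refl p r) (halve₃ b′ c′ refl q s) refl =
  cong₂ (λ b c → b +ᶻ + 4 *ᶻ c +ᶻ + 3 , b)
    (cancel 2 (combine (+ 1) (+ 1) (trans (sym p) q) (trans (sym r) s) (eq₁ b b′ c c′)))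
    (cancel 1 (scale (- (+ 1)) (trans (sym r) s) (eq₂ c c′)))
  where
  eq₁ : ∀ b b′ c c′ → + 2 *ᶻ (b -ᶻ b′) ≡ + 1 *ᶻ ((+ 2 *ᶻ b +ᶻ c +ᶻ + 1) -ᶻ (+ 2 *ᶻ b′ +ᶻ c′ +ᶻ + 1))
                                       +ᶻ + 1 *ᶻ ((- c -ᶻ + 1) -ᶻ (- c′ -ᶻ + 1))
  eq₁ = solve-∀
  eq₂ : ∀ c c′ → + 1 *ᶻ (c -ᶻ c′) ≡ - (+ 1) *ᶻ ((- c -ᶻ + 1) -ᶻ (- c′ -ᶻ + 1))
  eq₂ = solve-∀
halve-injective (halve₁ b c refl p r) (halve₃ b′ c′ refl q s) refl =
  ⊥-elim (halve-disjoint′ b b′ c c′ (trans (sym p) q) (trans (sym r) s))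
halve-injective (halve₃ b c refl p r) (halve₁ b′ c′ refl q s) refl =
  ⊥-elim (halve-disjoint′ b′ b c′ c (trans (sym q) p) (trans (sym s) r))

-- The multiplier has norm (1 + 7)/16 = 1/2.
halve-form : ∀ {a b a′ b′} → Halve (a , b) (a′ , b′) →
             form (four a) (four b) ≡ + 2 *ᶻ form (four a′) (four b′)
halve-form (halve₁ b c refl refl refl) = eq b c
  where
  eq : ∀ b c → (+ 4 *ᶻ (b +ᶻ + 4 *ᶻ c +ᶻ + 1) +ᶻ + 1) *ᶻ (+ 4 *ᶻ (b +ᶻ + 4 *ᶻ c +ᶻ + 1) +ᶻ + 1)
               +ᶻ + 7 *ᶻ ((+ 4 *ᶻ b +ᶻ + 1) *ᶻ (+ 4 *ᶻ b +ᶻ + 1))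
             ≡ + 2 *ᶻ ((+ 4 *ᶻ (- (+ 2 *ᶻ b) -ᶻ c -ᶻ + 1) +ᶻ + 1) *ᶻ (+ 4 *ᶻ (- (+ 2 *ᶻ b) -ᶻ c -ᶻ + 1) +ᶻ + 1)
               +ᶻ + 7 *ᶻ ((+ 4 *ᶻ c +ᶻ + 1) *ᶻ (+ 4 *ᶻ c +ᶻ + 1)))
  eq = solve-∀
halve-form (halve₃ b c refl refl refl) = eq b c
  where
  eq : ∀ b c → (+ 4 *ᶻ (b +ᶻ + 4 *ᶻ c +ᶻ + 3) +ᶻ + 1) *ᶻ (+ 4 *ᶻ (b +ᶻ + 4 *ᶻ c +ᶻ + 3) +ᶻ + 1)
               +ᶻ + 7 *ᶻ ((+ 4 *ᶻ b +ᶻ + 1) *ᶻ (+ 4 *ᶻ b +ᶻ + 1))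
             ≡ + 2 *ᶻ ((+ 4 *ᶻ (+ 2 *ᶻ b +ᶻ c +ᶻ + 1) +ᶻ + 1) *ᶻ (+ 4 *ᶻ (+ 2 *ᶻ b +ᶻ c +ᶻ + 1) +ᶻ + 1)
               +ᶻ + 7 *ᶻ ((+ 4 *ᶻ (- c -ᶻ + 1) +ᶻ + 1) *ᶻ (+ 4 *ᶻ (- c -ᶻ + 1) +ᶻ + 1)))
  eq = solve-∀

move : ∀ a b {z} → a -ᶻ b ≡ z → a ≡ b +ᶻ z
move a b refl = eq a b
  where
  eq : ∀ a b → a ≡ b +ᶻ (a -ᶻ b)
  eq = solve-∀

-- Substituting x = y + 4 (a - b) in x² + 7 y² = 8 N gives N = y² + (a - b) y + 2 (a - b)². As y is
-- odd, N is odd exactly when a - b is even. The proof reads this off modulo 16, before division by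
-- 8.
even-difference : ∀ {a b} d K → a -ᶻ b ≡ + 2 *ᶻ d +ᶻ + 0 → ¬ Four (+ 2 *ᶻ K) (a , b)
even-difference {a} {b} d K diff eq with refl ← move a b diff =
  indivisible 16 8 (K -ᶻ (b +ᶻ + 2 *ᶻ d) *ᶻ (b +ᶻ + 2 *ᶻ d) -ᶻ + 7 *ᶻ (b *ᶻ b) -ᶻ + 4 *ᶻ b -ᶻ d)
    (scale (- (+ 1)) eq (identity b d K))
  where
  identity : ∀ b d K →
    + 16 *ᶻ (K -ᶻ (b +ᶻ + 2 *ᶻ d) *ᶻ (b +ᶻ + 2 *ᶻ d) -ᶻ + 7 *ᶻ (b *ᶻ b) -ᶻ + 4 *ᶻ b -ᶻ d) -ᶻ + 8
    ≡ - (+ 1) *ᶻ (((+ 4 *ᶻ (b +ᶻ (+ 2 *ᶻ d +ᶻ + 0)) +ᶻ + 1) *ᶻ (+ 4 *ᶻ (b +ᶻ (+ 2 *ᶻ d +ᶻ + 0)) +ᶻ + 1)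
        +ᶻ + 7 *ᶻ ((+ 4 *ᶻ b +ᶻ + 1) *ᶻ (+ 4 *ᶻ b +ᶻ + 1))) -ᶻ + 8 *ᶻ (+ 2 *ᶻ K))
  identity = solve-∀

odd-difference : ∀ {a b} d K → a -ᶻ b ≡ + 2 *ᶻ d +ᶻ + 1 → ¬ Four (+ 2 *ᶻ K +ᶻ + 1) (a , b)
odd-difference {a} {b} d K diff eq with refl ← move a b diff =
  indivisible 16 8 (a *ᶻ a +ᶻ + 7 *ᶻ (b *ᶻ b) +ᶻ + 4 *ᶻ b +ᶻ d +ᶻ + 1 -ᶻ K)
    (scale (+ 1) eq (identity b d K))
  where
  identity : ∀ b d K →
    + 16 *ᶻ ((b +ᶻ (+ 2 *ᶻ d +ᶻ + 1)) *ᶻ (b +ᶻ (+ 2 *ᶻ d +ᶻ + 1)) +ᶻ + 7 *ᶻ (b *ᶻ b) +ᶻ + 4 *ᶻ b +ᶻ d +ᶻ + 1 -ᶻ K) -ᶻ + 8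
    ≡ + 1 *ᶻ (((+ 4 *ᶻ (b +ᶻ (+ 2 *ᶻ d +ᶻ + 1)) +ᶻ + 1) *ᶻ (+ 4 *ᶻ (b +ᶻ (+ 2 *ᶻ d +ᶻ + 1)) +ᶻ + 1)
        +ᶻ + 7 *ᶻ ((+ 4 *ᶻ b +ᶻ + 1) *ᶻ (+ 4 *ᶻ b +ᶻ + 1))) -ᶻ + 8 *ᶻ (+ 2 *ᶻ K +ᶻ + 1))
  identity = solve-∀

halving : ∀ K → Matching (Four (+ 2 *ᶻ K)) (Four K) Halve
halving K = record
  { forth = forth ; back = back ; functional = halve-functional ; injective = halve-injective }
  where
  double : ∀ z → + 2 *ᶻ (+ 8 *ᶻ z) ≡ + 8 *ᶻ (+ 2 *ᶻ z)
  double = solve-∀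

  descend : ∀ {x y} → Halve x y → Four (+ 2 *ᶻ K) x → Four K y
  descend h eq = ℤ.*-cancelˡ-≡ (+ 2) _ _ (trans (sym (halve-form h)) (trans eq (sym (double K))))

  ascend : ∀ {x y} → Halve x y → Four K y → Four (+ 2 *ᶻ K) x
  ascend h eq = trans (halve-form h) (trans (cong (+ 2 *ᶻ_) eq) (double K))

  forth : ∀ x → Four (+ 2 *ᶻ K) x → ∃ λ y → Four K y × Halve x y
  forth (a , b) eq with remainder 2 (a -ᶻ b)
  ... | zero , d , diff = ⊥-elim (even-difference {a} {b} d K diff eq)
  -- The residue of a - b modulo 4 decides the sign that brings the quotient back into 1 + 4 ℤ.
  ... | suc zero , d , diff with remainder 2 d
  ...   | zero , c , refl = _ , descend h eq , h
    where
    rearrange : ∀ b c → b +ᶻ (+ 2 *ᶻ (+ 2 *ᶻ c +ᶻ + 0) +ᶻ + 1) ≡ b +ᶻ + 4 *ᶻ c +ᶻ + 1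
    rearrange = solve-∀
    h = halve₁ b c (trans (move a b diff) (rearrange b c)) refl refl
  ...   | suc zero , c , refl = _ , descend h eq , h
    where
    rearrange : ∀ b c → b +ᶻ (+ 2 *ᶻ (+ 2 *ᶻ c +ᶻ + 1) +ᶻ + 1) ≡ b +ᶻ + 4 *ᶻ c +ᶻ + 3
    rearrange = solve-∀
    h = halve₃ b c (trans (move a b diff) (rearrange b c)) refl refl

  back : ∀ y → Four K y → ∃ λ x → Four (+ 2 *ᶻ K) x × Halve x y
  -- If e is the second coordinate of the preimage, then a + b is -2 e - 1 under `halve₁` and 2 e
  -- under `halve₃`, so the parity of a + b selects the constructor.
  back (a , b) eq with remainder 2 (a -ᶻ - b)
  ... | zero , e , diff = _ , ascend h eq , h
    where
    rearrange₁ : ∀ b e → - b +ᶻ (+ 2 *ᶻ e +ᶻ + 0) ≡ + 2 *ᶻ e +ᶻ (- b -ᶻ + 1) +ᶻ + 1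
    rearrange₁ = solve-∀
    rearrange₂ : ∀ b → b ≡ - (- b -ᶻ + 1) -ᶻ + 1
    rearrange₂ = solve-∀
    h = halve₃ e (- b -ᶻ + 1) refl (trans (move a (- b) diff) (rearrange₁ b e)) (rearrange₂ b)
  ... | suc zero , e , diff = _ , ascend h eq , h
    where
    rearrange : ∀ b e → - b +ᶻ (+ 2 *ᶻ e +ᶻ + 1) ≡ - (+ 2 *ᶻ (- e -ᶻ + 1)) -ᶻ b -ᶻ + 1
    rearrange = solve-∀
    h = halve₁ (- e -ᶻ + 1) b refl (trans (move a (- b) diff) (rearrange b e)) refl

-- (1 ± √-7) (u + v √-7) is sent to (1 ± √-7) (u - v √-7), with signs chosen to stay in 1 + 4 ℤ.
data Flip : ℤ × ℤ → ℤ × ℤ → Set where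
  flip₀ : ∀ b j {a a′ b′} → a ≡ b +ᶻ + 4 *ᶻ j → a′ ≡ b -ᶻ + 3 *ᶻ j → b′ ≡ b +ᶻ j → Flip (a , b) (a′ , b′)
  flip₂ : ∀ b j {a a′ b′} → a ≡ b +ᶻ + 4 *ᶻ j +ᶻ + 2 → a′ ≡ - b +ᶻ + 3 *ᶻ j +ᶻ + 1 → b′ ≡ - b -ᶻ j -ᶻ + 1 →
          Flip (a , b) (a′ , b′)

flip-symmetric : ∀ {x y} → Flip x y → Flip y x
flip-symmetric (flip₀ b j refl refl refl) = flip₀ (b +ᶻ j) (- j) (eq₁ b j) (eq₂ b j) (eq₃ b j)
  where
  eq₁ : ∀ b j → b -ᶻ + 3 *ᶻ j ≡ b +ᶻ j +ᶻ + 4 *ᶻ (- j)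
  eq₁ = solve-∀
  eq₂ : ∀ b j → b +ᶻ + 4 *ᶻ j ≡ b +ᶻ j -ᶻ + 3 *ᶻ (- j)
  eq₂ = solve-∀
  eq₃ : ∀ b j → b ≡ b +ᶻ j +ᶻ - j
  eq₃ = solve-∀
flip-symmetric (flip₂ b j refl refl refl) = flip₂ (- b -ᶻ j -ᶻ + 1) j (eq₁ b j) (eq₂ b j) (eq₃ b j)
  where
  eq₁ : ∀ b j → - b +ᶻ + 3 *ᶻ j +ᶻ + 1 ≡ - b -ᶻ j -ᶻ + 1 +ᶻ + 4 *ᶻ j +ᶻ + 2
  eq₁ = solve-∀
  eq₂ : ∀ b j → b +ᶻ + 4 *ᶻ j +ᶻ + 2 ≡ - (- b -ᶻ j -ᶻ + 1) +ᶻ + 3 *ᶻ j +ᶻ + 1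
  eq₂ = solve-∀
  eq₃ : ∀ b j → b ≡ - (- b -ᶻ j -ᶻ + 1) -ᶻ j -ᶻ + 1
  eq₃ = solve-∀

flip-disjoint : ∀ b j j′ → b +ᶻ + 4 *ᶻ j ≢ b +ᶻ + 4 *ᶻ j′ +ᶻ + 2
flip-disjoint b j j′ p = indivisible 4 2 (j -ᶻ j′) (scale (+ 1) p (eq b j j′))
  where
  eq : ∀ b j j′ → + 4 *ᶻ (j -ᶻ j′) -ᶻ + 2 ≡ + 1 *ᶻ ((b +ᶻ + 4 *ᶻ j) -ᶻ (b +ᶻ + 4 *ᶻ j′ +ᶻ + 2))
  eq = solve-∀

flip-functional : ∀ {x x′ y y′} → Flip x y → Flip x′ y′ → x ≡ x′ → y ≡ y′
flip-functional (flip₀ b j p refl refl) (flip₀ _ j′ q refl refl) refl =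
  cong (λ j → b -ᶻ + 3 *ᶻ j , b +ᶻ j) (cancel 4 (scale (+ 1) (trans (sym p) q) (eq b j j′)))
  where
  eq : ∀ b j j′ → + 4 *ᶻ (j -ᶻ j′) ≡ + 1 *ᶻ ((b +ᶻ + 4 *ᶻ j) -ᶻ (b +ᶻ + 4 *ᶻ j′))
  eq = solve-∀
flip-functional (flip₂ b j p refl refl) (flip₂ _ j′ q refl refl) refl =
  cong (λ j → - b +ᶻ + 3 *ᶻ j +ᶻ + 1 , - b -ᶻ j -ᶻ + 1) (cancel 4 (scale (+ 1) (trans (sym p) q) (eq b j j′)))
  where
  eq : ∀ b j j′ → + 4 *ᶻ (j -ᶻ j′) ≡ + 1 *ᶻ ((b +ᶻ + 4 *ᶻ j +ᶻ + 2) -ᶻ (b +ᶻ + 4 *ᶻ j′ +ᶻ + 2))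
  eq = solve-∀
flip-functional (flip₀ b j p refl refl) (flip₂ _ j′ q refl refl) refl =
  ⊥-elim (flip-disjoint b j j′ (trans (sym p) q))
flip-functional (flip₂ b j p refl refl) (flip₀ _ j′ q refl refl) refl =
  ⊥-elim (flip-disjoint b j′ j (trans (sym q) p))

flip-form : ∀ {a b a′ b′} → Flip (a , b) (a′ , b′) → form (four a) (four b) ≡ form (four a′) (four b′)
flip-form (flip₀ b j refl refl refl) = eq b j
  where
  eq : ∀ b j → (+ 4 *ᶻ (b +ᶻ + 4 *ᶻ j) +ᶻ + 1) *ᶻ (+ 4 *ᶻ (b +ᶻ + 4 *ᶻ j) +ᶻ + 1)
               +ᶻ + 7 *ᶻ ((+ 4 *ᶻ b +ᶻ + 1) *ᶻ (+ 4 *ᶻ b +ᶻ + 1))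
             ≡ (+ 4 *ᶻ (b -ᶻ + 3 *ᶻ j) +ᶻ + 1) *ᶻ (+ 4 *ᶻ (b -ᶻ + 3 *ᶻ j) +ᶻ + 1)
               +ᶻ + 7 *ᶻ ((+ 4 *ᶻ (b +ᶻ j) +ᶻ + 1) *ᶻ (+ 4 *ᶻ (b +ᶻ j) +ᶻ + 1))
  eq = solve-∀
flip-form (flip₂ b j refl refl refl) = eq b j
  where
  eq : ∀ b j → (+ 4 *ᶻ (b +ᶻ + 4 *ᶻ j +ᶻ + 2) +ᶻ + 1) *ᶻ (+ 4 *ᶻ (b +ᶻ + 4 *ᶻ j +ᶻ + 2) +ᶻ + 1)
               +ᶻ + 7 *ᶻ ((+ 4 *ᶻ b +ᶻ + 1) *ᶻ (+ 4 *ᶻ b +ᶻ + 1))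
             ≡ (+ 4 *ᶻ (- b +ᶻ + 3 *ᶻ j +ᶻ + 1) +ᶻ + 1) *ᶻ (+ 4 *ᶻ (- b +ᶻ + 3 *ᶻ j +ᶻ + 1) +ᶻ + 1)
               +ᶻ + 7 *ᶻ ((+ 4 *ᶻ (- b -ᶻ j -ᶻ + 1) +ᶻ + 1) *ᶻ (+ 4 *ᶻ (- b -ᶻ j -ᶻ + 1) +ᶻ + 1))
  eq = solve-∀

-- Write x + y √-7 = (1 + √-7) (u + v √-7), so that N = u² + 7 v². A fixed point of `flip₀` has v =
-- 0 and u = y; one of `flip₂` has u = 0 and v = y.
flip-irreflexive : ∀ {N} → (∀ u → u *ᶻ u ≢ N) → (∀ u → + 7 *ᶻ (u *ᶻ u) ≢ N) →
                   ∀ {x y} → Four N x → Flip x y → x ≢ y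
flip-irreflexive {N} □ 7□ eq (flip₀ b j {a} p _ r) refl =
  □ (four b) (cancel 8 (scale (+ 1) (subst (λ a → form (four a) (four b) ≡ + 8 *ᶻ N) a≡b eq)
                              (identity (four b) N)))
  where
  difference : ∀ a b j → + 1 *ᶻ (a -ᶻ b) ≡ + 1 *ᶻ (a -ᶻ (b +ᶻ + 4 *ᶻ j)) +ᶻ - (+ 4) *ᶻ (b -ᶻ (b +ᶻ j))
  difference = solve-∀
  a≡b : a ≡ b
  a≡b = cancel 1 (combine (+ 1) (- (+ 4)) p r (difference a b j))
  identity : ∀ y N → + 8 *ᶻ (y *ᶻ y -ᶻ N) ≡ + 1 *ᶻ ((y *ᶻ y +ᶻ + 7 *ᶻ (y *ᶻ y)) -ᶻ + 8 *ᶻ N)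
  identity = solve-∀
flip-irreflexive {N} □ 7□ eq (flip₂ b j {a} p _ r) refl =
  7□ (four b) (cancel 8 (scale (+ 1) (subst (λ a → form (four a) (four b) ≡ + 8 *ᶻ N) a≡-7b-2 eq)
                               (identity b N)))
  where
  difference : ∀ a b j → + 1 *ᶻ (a -ᶻ (- (+ 7) *ᶻ b -ᶻ + 2))
             ≡ + 1 *ᶻ (a -ᶻ (b +ᶻ + 4 *ᶻ j +ᶻ + 2)) +ᶻ + 4 *ᶻ (b -ᶻ (- b -ᶻ j -ᶻ + 1))
  difference = solve-∀
  a≡-7b-2 : a ≡ - (+ 7) *ᶻ b -ᶻ + 2
  a≡-7b-2 = cancel 1 (combine (+ 1) (+ 4) p r (difference a b j))
  identity : ∀ b N → + 8 *ᶻ (+ 7 *ᶻ ((+ 4 *ᶻ b +ᶻ + 1) *ᶻ (+ 4 *ᶻ b +ᶻ + 1)) -ᶻ N)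
    ≡ + 1 *ᶻ (((+ 4 *ᶻ (- (+ 7) *ᶻ b -ᶻ + 2) +ᶻ + 1) *ᶻ (+ 4 *ᶻ (- (+ 7) *ᶻ b -ᶻ + 2) +ᶻ + 1)
              +ᶻ + 7 *ᶻ ((+ 4 *ᶻ b +ᶻ + 1) *ᶻ (+ 4 *ᶻ b +ᶻ + 1))) -ᶻ + 8 *ᶻ N)
  identity = solve-∀

flipping : ∀ K → (∀ u → u *ᶻ u ≢ + 2 *ᶻ K +ᶻ + 1) → (∀ u → + 7 *ᶻ (u *ᶻ u) ≢ + 2 *ᶻ K +ᶻ + 1) →
           Pairing (Four (+ 2 *ᶻ K +ᶻ + 1)) Flip
flipping K □ 7□ = record
  { partner = partner ; symmetric = flip-symmetric ; functional = flip-functional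
  ; irreflexive = flip-irreflexive □ 7□ }
  where
  partner : ∀ x → Four (+ 2 *ᶻ K +ᶻ + 1) x → ∃ λ y → Four (+ 2 *ᶻ K +ᶻ + 1) y × Flip x y
  partner (a , b) eq with remainder 2 (a -ᶻ b)
  ... | suc zero , d , diff = ⊥-elim (odd-difference {a} {b} d K diff eq)
  -- Here d = -v for the cofactor u + v √-7. For odd v both new coordinates are 3 modulo 4 and have
  -- to change sign.
  ... | zero , d , diff with remainder 2 d
  ...   | zero , j , refl = _ , trans (sym (flip-form h)) eq , h
    where
    rearrange : ∀ b j → b +ᶻ (+ 2 *ᶻ (+ 2 *ᶻ j +ᶻ + 0) +ᶻ + 0) ≡ b +ᶻ + 4 *ᶻ j
    rearrange = solve-∀
    h = flip₀ b j (trans (move a b diff) (rearrange b j)) refl refl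
  ...   | suc zero , j , refl = _ , trans (sym (flip-form h)) eq , h
    where
    rearrange : ∀ b j → b +ᶻ (+ 2 *ᶻ (+ 2 *ᶻ j +ᶻ + 1) +ᶻ + 0) ≡ b +ᶻ + 4 *ᶻ j +ᶻ + 2
    rearrange = solve-∀
    h = flip₂ b j (trans (move a b diff) (rearrange b j)) refl refl

-- From integers prime to 6 to odd integers

data Agree (a c : ℤ) : Set where
  same     : six a ≡ four c → Agree a c
  opposite : six a ≡ - four c → Agree a c

four-injective : ∀ {c c′} → four c ≡ four c′ → c ≡ c′
four-injective {c} {c′} p = cancel 4 (scale (+ 1) p (eq c c′))
  where
  eq : ∀ c c′ → + 4 *ᶻ (c -ᶻ c′) ≡ + 1 *ᶻ ((+ 4 *ᶻ c +ᶻ + 1) -ᶻ (+ 4 *ᶻ c′ +ᶻ + 1))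
  eq = solve-∀

four≢-four : ∀ {c c′} → four c ≢ - four c′
four≢-four {c} {c′} p = indivisible 4 2 (- c -ᶻ c′) (scale (- (+ 1)) p (eq c c′))
  where
  eq : ∀ c c′ → + 4 *ᶻ (- c -ᶻ c′) -ᶻ + 2 ≡ - (+ 1) *ᶻ ((+ 4 *ᶻ c +ᶻ + 1) -ᶻ - (+ 4 *ᶻ c′ +ᶻ + 1))
  eq = solve-∀

six-injective : ∀ {a a′} → six a ≡ six a′ → a ≡ a′
six-injective {a} {a′} p = cancel 6 (scale (+ 1) p (eq a a′))
  where
  eq : ∀ a a′ → + 6 *ᶻ (a -ᶻ a′) ≡ + 1 *ᶻ ((+ 6 *ᶻ a +ᶻ + 1) -ᶻ (+ 6 *ᶻ a′ +ᶻ + 1))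
  eq = solve-∀

six≢-six : ∀ {a a′} → six a ≢ - six a′
six≢-six {a} {a′} p = indivisible 6 2 (- a -ᶻ a′) (scale (- (+ 1)) p (eq a a′))
  where
  eq : ∀ a a′ → + 6 *ᶻ (- a -ᶻ a′) -ᶻ + 2 ≡ - (+ 1) *ᶻ ((+ 6 *ᶻ a +ᶻ + 1) -ᶻ - (+ 6 *ᶻ a′ +ᶻ + 1))
  eq = solve-∀

agree-functional : ∀ {a c c′} → Agree a c → Agree a c′ → c ≡ c′
agree-functional (same p) (same q) = four-injective (trans (sym p) q)
agree-functional (opposite p) (opposite q) = four-injective (ℤ.neg-injective (trans (sym p) q))
agree-functional {_} {c} {c′} (same p) (opposite q) = ⊥-elim (four≢-four {c} {c′} (trans (sym p) q))
agree-functional {c = c} {c′} (opposite p) (same q) = ⊥-elim (four≢-four {c′} {c} (trans (sym q) p))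

agree-injective : ∀ {a a′ c} → Agree a c → Agree a′ c → a ≡ a′
agree-injective (same p) (same q) = six-injective (trans p (sym q))
agree-injective (opposite p) (opposite q) = six-injective (trans p (sym q))
agree-injective {a} {a′} (same p) (opposite q) =
  ⊥-elim (six≢-six {a′} {a} (trans q (cong -_ (sym p))))
agree-injective {a} {a′} (opposite p) (same q) =
  ⊥-elim (six≢-six {a} {a′} (trans p (cong -_ (sym q))))

agree-square : ∀ {a c} → Agree a c → six a *ᶻ six a ≡ four c *ᶻ four c
agree-square (same p) = cong₂ _*ᶻ_ p p
agree-square {c = c} (opposite p) = trans (cong₂ _*ᶻ_ p p) (eq (four c))
  where
  eq : ∀ z → - z *ᶻ - z ≡ z *ᶻ z
  eq = solve-∀

agree-forth : ∀ a → ∃ (Agree a)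
agree-forth a with remainder 2 a
... | zero , c , refl = + 3 *ᶻ c , same (eq c)
  where
  eq : ∀ c → + 6 *ᶻ (+ 2 *ᶻ c +ᶻ + 0) +ᶻ + 1 ≡ + 4 *ᶻ (+ 3 *ᶻ c) +ᶻ + 1
  eq = solve-∀
... | suc zero , c , refl = - (+ 3) *ᶻ c -ᶻ + 2 , opposite (eq c)
  where
  eq : ∀ c → + 6 *ᶻ (+ 2 *ᶻ c +ᶻ + 1) +ᶻ + 1 ≡ - (+ 4 *ᶻ (- (+ 3) *ᶻ c -ᶻ + 2) +ᶻ + 1)
  eq = solve-∀

agree-back : ∀ c → (∃ λ a → Agree a c) ⊎ ∃ λ z → four c ≡ + 3 *ᶻ z
agree-back c with remainder 3 c
... | zero , e , refl = inj₁ (+ 2 *ᶻ e , same (eq e))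
  where
  eq : ∀ e → + 6 *ᶻ (+ 2 *ᶻ e) +ᶻ + 1 ≡ + 4 *ᶻ (+ 3 *ᶻ e +ᶻ + 0) +ᶻ + 1
  eq = solve-∀
... | suc zero , e , refl = inj₁ (- (+ 2) *ᶻ e -ᶻ + 1 , opposite (eq e))
  where
  eq : ∀ e → + 6 *ᶻ (- (+ 2) *ᶻ e -ᶻ + 1) +ᶻ + 1 ≡ - (+ 4 *ᶻ (+ 3 *ᶻ e +ᶻ + 1) +ᶻ + 1)
  eq = solve-∀
... | suc (suc zero) , e , refl = inj₂ (+ 4 *ᶻ e +ᶻ + 3 , eq e)
  where
  eq : ∀ e → + 4 *ᶻ (+ 3 *ᶻ e +ᶻ + 2) +ᶻ + 1 ≡ + 3 *ᶻ (+ 4 *ᶻ e +ᶻ + 3)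
  eq = solve-∀

-- Modulo 3 the form is x² + y² and the right side is 2, so x ≡ 0 would make 2 a square.
form-3ˡ : ∀ z y K → form (+ 3 *ᶻ z) y ≢ + 8 *ᶻ (+ 3 *ᶻ K +ᶻ + 1)
form-3ˡ z y K p with remainder 3 y
... | zero , f , refl =
  indivisible 3 8 (+ 3 *ᶻ (z *ᶻ z) +ᶻ + 21 *ᶻ (f *ᶻ f) -ᶻ + 8 *ᶻ K) (scale (+ 1) p (eq z f K))
  where
  eq : ∀ z f K → + 3 *ᶻ (+ 3 *ᶻ (z *ᶻ z) +ᶻ + 21 *ᶻ (f *ᶻ f) -ᶻ + 8 *ᶻ K) -ᶻ + 8
     ≡ + 1 *ᶻ ((+ 3 *ᶻ z *ᶻ (+ 3 *ᶻ z) +ᶻ + 7 *ᶻ ((+ 3 *ᶻ f +ᶻ + 0) *ᶻ (+ 3 *ᶻ f +ᶻ + 0)))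
               -ᶻ + 8 *ᶻ (+ 3 *ᶻ K +ᶻ + 1))
  eq = solve-∀
... | suc zero , f , refl =
  indivisible 3 1 (+ 3 *ᶻ (z *ᶻ z) +ᶻ + 21 *ᶻ (f *ᶻ f) +ᶻ + 14 *ᶻ f -ᶻ + 8 *ᶻ K) (scale (+ 1) p (eq z f K))
  where
  eq : ∀ z f K → + 3 *ᶻ (+ 3 *ᶻ (z *ᶻ z) +ᶻ + 21 *ᶻ (f *ᶻ f) +ᶻ + 14 *ᶻ f -ᶻ + 8 *ᶻ K) -ᶻ + 1
     ≡ + 1 *ᶻ ((+ 3 *ᶻ z *ᶻ (+ 3 *ᶻ z) +ᶻ + 7 *ᶻ ((+ 3 *ᶻ f +ᶻ + 1) *ᶻ (+ 3 *ᶻ f +ᶻ + 1)))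
               -ᶻ + 8 *ᶻ (+ 3 *ᶻ K +ᶻ + 1))
  eq = solve-∀
... | suc (suc zero) , f , refl =
  indivisible 3 1 (+ 3 *ᶻ (z *ᶻ z) +ᶻ + 21 *ᶻ (f *ᶻ f) +ᶻ + 28 *ᶻ f +ᶻ + 7 -ᶻ + 8 *ᶻ K) (scale (+ 1) p (eq z f K))
  where
  eq : ∀ z f K → + 3 *ᶻ (+ 3 *ᶻ (z *ᶻ z) +ᶻ + 21 *ᶻ (f *ᶻ f) +ᶻ + 28 *ᶻ f +ᶻ + 7 -ᶻ + 8 *ᶻ K) -ᶻ + 1
     ≡ + 1 *ᶻ ((+ 3 *ᶻ z *ᶻ (+ 3 *ᶻ z) +ᶻ + 7 *ᶻ ((+ 3 *ᶻ f +ᶻ + 2) *ᶻ (+ 3 *ᶻ f +ᶻ + 2)))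
               -ᶻ + 8 *ᶻ (+ 3 *ᶻ K +ᶻ + 1))
  eq = solve-∀

form-3ʳ : ∀ x z K → form x (+ 3 *ᶻ z) ≢ + 8 *ᶻ (+ 3 *ᶻ K +ᶻ + 1)
form-3ʳ x z K p with remainder 3 x
... | zero , f , refl =
  indivisible 3 8 (+ 3 *ᶻ (f *ᶻ f) +ᶻ + 21 *ᶻ (z *ᶻ z) -ᶻ + 8 *ᶻ K) (scale (+ 1) p (eq z f K))
  where
  eq : ∀ z f K → + 3 *ᶻ (+ 3 *ᶻ (f *ᶻ f) +ᶻ + 21 *ᶻ (z *ᶻ z) -ᶻ + 8 *ᶻ K) -ᶻ + 8
     ≡ + 1 *ᶻ (((+ 3 *ᶻ f +ᶻ + 0) *ᶻ (+ 3 *ᶻ f +ᶻ + 0) +ᶻ + 7 *ᶻ (+ 3 *ᶻ z *ᶻ (+ 3 *ᶻ z)))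
               -ᶻ + 8 *ᶻ (+ 3 *ᶻ K +ᶻ + 1))
  eq = solve-∀
... | suc zero , f , refl =
  indivisible 3 7 (+ 3 *ᶻ (f *ᶻ f) +ᶻ + 2 *ᶻ f +ᶻ + 21 *ᶻ (z *ᶻ z) -ᶻ + 8 *ᶻ K) (scale (+ 1) p (eq z f K))
  where
  eq : ∀ z f K → + 3 *ᶻ (+ 3 *ᶻ (f *ᶻ f) +ᶻ + 2 *ᶻ f +ᶻ + 21 *ᶻ (z *ᶻ z) -ᶻ + 8 *ᶻ K) -ᶻ + 7
     ≡ + 1 *ᶻ (((+ 3 *ᶻ f +ᶻ + 1) *ᶻ (+ 3 *ᶻ f +ᶻ + 1) +ᶻ + 7 *ᶻ (+ 3 *ᶻ z *ᶻ (+ 3 *ᶻ z)))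
               -ᶻ + 8 *ᶻ (+ 3 *ᶻ K +ᶻ + 1))
  eq = solve-∀
... | suc (suc zero) , f , refl =
  indivisible 3 4 (+ 3 *ᶻ (f *ᶻ f) +ᶻ + 4 *ᶻ f +ᶻ + 21 *ᶻ (z *ᶻ z) -ᶻ + 8 *ᶻ K) (scale (+ 1) p (eq z f K))
  where
  eq : ∀ z f K → + 3 *ᶻ (+ 3 *ᶻ (f *ᶻ f) +ᶻ + 4 *ᶻ f +ᶻ + 21 *ᶻ (z *ᶻ z) -ᶻ + 8 *ᶻ K) -ᶻ + 4
     ≡ + 1 *ᶻ (((+ 3 *ᶻ f +ᶻ + 2) *ᶻ (+ 3 *ᶻ f +ᶻ + 2) +ᶻ + 7 *ᶻ (+ 3 *ᶻ z *ᶻ (+ 3 *ᶻ z)))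
               -ᶻ + 8 *ᶻ (+ 3 *ᶻ K +ᶻ + 1))
  eq = solve-∀

-- The pentagonal numbers supply coordinates prime to 6, while division by ω needs all odd ones. For
-- N ≡ 1 modulo 3 nothing is gained by the larger range: an odd solution has no coordinate divisible
-- by 3.
signs : ∀ K → Matching (Six (+ 3 *ᶻ K +ᶻ + 1)) (Four (+ 3 *ᶻ K +ᶻ + 1))
                       (λ x y → Agree (proj₁ x) (proj₁ y) × Agree (proj₂ x) (proj₂ y))
signs K = record
  { forth = λ (a , b) eq → let c , p = agree-forth a ; d , q = agree-forth b in
      (c , d) , trans (sym (agree-form p q)) eq , p , q
  ; back = back
  ; functional = λ { (p , q) (p′ , q′) refl → cong₂ _,_ (agree-functional p p′) (agree-functional q q′) }
  ; injective = λ { (p , q) (p′ , q′) refl → cong₂ _,_ (agree-injective p p′) (agree-injective q q′) } }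
  where
  agree-form : ∀ {a b c d} → Agree a c → Agree b d → form (six a) (six b) ≡ form (four c) (four d)
  agree-form p q = cong₂ (λ s t → s +ᶻ + 7 *ᶻ t) (agree-square p) (agree-square q)

  back : ∀ y → Four (+ 3 *ᶻ K +ᶻ + 1) y →
         ∃ λ x → Six (+ 3 *ᶻ K +ᶻ + 1) x × Agree (proj₁ x) (proj₁ y) × Agree (proj₂ x) (proj₂ y)
  back (c , d) eq with agree-back c | agree-back d
  ... | inj₁ (a , p) | inj₁ (b , q) = (a , b) , trans (agree-form p q) eq , p , q
  ... | inj₂ (z , p) | _ = ⊥-elim (form-3ˡ z (four d) K (trans (cong (λ x → form x (four d)) (sym p)) eq))
  ... | inj₁ _ | inj₂ (z , p) = ⊥-elim (form-3ʳ (four c) z K (trans (cong (form (four c)) (sym p)) eq))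

-- Complete lists of solutions

ball-bound : ∀ n {a} → a ∈ ball n → ∣ a ∣ ≤ n
ball-bound zero    (here refl)         = z≤n
ball-bound (suc n) (here refl)         = ℕ.≤-refl
ball-bound (suc n) (there (here refl)) = ℕ.≤-refl
ball-bound (suc n) (there (there a∈))  = ℕ.m≤n⇒m≤1+n (ball-bound n a∈)

∈-ball : ∀ n {a} → ∣ a ∣ ≤ n → a ∈ ball n
∈-ball zero    {+ zero} _ = here refl
∈-ball (suc n) {a} a≤ with ℕ.m≤n⇒m<n∨m≡n a≤
... | inj₁ (s≤s a≤n) = there (there (∈-ball n a≤n))
∈-ball (suc n) {+ _}     a≤ | inj₂ refl = here refl
∈-ball (suc n) { -[1+ _ ]} a≤ | inj₂ refl = there (here refl)

ball-unique : ∀ n → Unique (ball n)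
ball-unique zero    = [] ∷ []
ball-unique (suc n) = ((λ ()) ∷ All.tabulate (λ a∈ → outside a∈ refl))
                    ∷ All.tabulate (λ a∈ → outside a∈ refl) ∷ ball-unique n
  where
  outside : ∀ {a b} → a ∈ ball n → ∣ b ∣ ≡ suc n → b ≢ a
  outside a∈ eq refl = ℕ.<-irrefl eq (s≤s (ball-bound n a∈))

solutions : (ℤ → ℕ) → ℕ → ℕ → List (ℤ × ℤ)
solutions w K m = filter (λ (a , b) → w a + 7 * w b ℕ.≟ m) (cartesianProduct (ball K) (ball K))

-- By g² = k w + 1, the equation w a + 7 w b = m is the form equation with right side k m + 1 + 7.
-- Since |a| ≤ w a, every solution lies in the box as soon as m ≤ K. It serves the pairs `six`,
-- `pent` with k = 24 and `four`, `tri` with k = 8.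
enumerates : ∀ (g : ℤ → ℤ) (w : ℤ → ℕ) k .{{_ : NonZero k}} {K m} →
             (∀ a → g a *ᶻ g a ≡ + k *ᶻ + w a +ᶻ + 1) → (∀ a → ∣ a ∣ ≤ w a) → m ≤ K →
             Enumerates (solutions w K m) (λ (a , b) → form (g a) (g b) ≡ + k *ᶻ + m +ᶻ + 8)
enumerates g w k {K} {m} square large m≤K = record
  { unique   = Unique.filter⁺ P? (Unique.cartesianProduct⁺ (ball-unique K) (ball-unique K))
  ; sound    = λ {x} x∈ → trans (value x) (cong (λ m → + k *ᶻ + m +ᶻ + 8) (proj₂ (∈-filter⁻ P? {xs = box} x∈)))
  ; complete = λ {x} eq → let a , b = x ; p = exact x eq in
      ∈-filter⁺ P? (∈-cartesianProduct⁺
        (∈-ball K (ℕ.≤-trans (large a) (ℕ.≤-trans (ℕ.m≤m+n _ _) (ℕ.≤-trans (ℕ.≤-reflexive p) m≤K))))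
        (∈-ball K (ℕ.≤-trans (large b) (ℕ.≤-trans (ℕ.m≤m+n (w b) (6 * w b)) (ℕ.≤-trans (ℕ.m≤n+m _ (w a)) (ℕ.≤-trans (ℕ.≤-reflexive p) m≤K)))))) p }
  where
  P? : Decidable (λ ((a , b) : ℤ × ℤ) → w a + 7 * w b ≡ m)
  P? (a , b) = w a + 7 * w b ℕ.≟ m
  box = cartesianProduct (ball K) (ball K)
  collect : ∀ k u v → k *ᶻ u +ᶻ + 1 +ᶻ + 7 *ᶻ (k *ᶻ v +ᶻ + 1) ≡ k *ᶻ (u +ᶻ + 7 *ᶻ v) +ᶻ + 8
  collect = solve-∀
  value : ∀ ((a , b) : ℤ × ℤ) → form (g a) (g b) ≡ + k *ᶻ + (w a + 7 * w b) +ᶻ + 8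
  value (a , b) = begin
    form (g a) (g b)
      ≡⟨ cong₂ (λ s t → s +ᶻ + 7 *ᶻ t) (square a) (square b) ⟩
    + k *ᶻ + w a +ᶻ + 1 +ᶻ + 7 *ᶻ (+ k *ᶻ + w b +ᶻ + 1)
      ≡⟨ collect (+ k) (+ w a) (+ w b) ⟩
    + k *ᶻ (+ w a +ᶻ + 7 *ᶻ + w b) +ᶻ + 8
      ≡⟨ cong (λ t → + k *ᶻ (+ w a +ᶻ t) +ᶻ + 8) (ℤ.pos-* 7 (w b)) ⟨
    + k *ᶻ + (w a + 7 * w b) +ᶻ + 8 ∎
  difference : ∀ k u v → k *ᶻ (u -ᶻ v) ≡ + 1 *ᶻ ((k *ᶻ u +ᶻ + 8) -ᶻ (k *ᶻ v +ᶻ + 8))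
  difference = solve-∀
  exact : ∀ ((a , b) : ℤ × ℤ) → form (g a) (g b) ≡ + k *ᶻ + m +ᶻ + 8 → w a + 7 * w b ≡ m
  exact (a , b) eq = ℤ.+-injective (cancel k (scale (+ 1) (trans (sym (value (a , b))) eq)
    (difference (+ k) (+ (w a + 7 * w b)) (+ m))))

triangle-double : ∀ n → 2 * triangle n ≡ n * suc n
triangle-double zero    = refl
triangle-double (suc n) = trans (eq₁ n (triangle n)) (trans (cong (_+_ (2 * suc n)) (triangle-double n)) (eq₂ n))
  where
  eq₁ : ∀ n t → 2 * (suc n + t) ≡ 2 * suc n + 2 * t
  eq₁ = ℕ.solve-∀
  eq₂ : ∀ n → 2 * suc n + n * suc n ≡ suc n * suc (suc n)
  eq₂ = ℕ.solve-∀

triangle-doubleᶻ : ∀ n → + 2 *ᶻ + triangle n ≡ + n *ᶻ (+ 1 +ᶻ + n)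
triangle-doubleᶻ n = trans (sym (ℤ.pos-* 2 (triangle n))) (trans (cong +_ (triangle-double n)) (ℤ.pos-* n (suc n)))

pent-square : ∀ a → six a *ᶻ six a ≡ + 24 *ᶻ + pent a +ᶻ + 1
pent-square (+ n) = begin
  six (+ n) *ᶻ six (+ n)                                  ≡⟨ eq₁ (+ n) ⟩
  + 24 *ᶻ (+ n *ᶻ + n) +ᶻ + 12 *ᶻ (+ n *ᶻ (+ 1 +ᶻ + n)) +ᶻ + 1
    ≡⟨ cong₂ (λ s t → + 24 *ᶻ s +ᶻ + 12 *ᶻ t +ᶻ + 1) (ℤ.pos-* n n) (triangle-doubleᶻ n) ⟨
  + 24 *ᶻ + (n * n) +ᶻ + 12 *ᶻ (+ 2 *ᶻ + triangle n) +ᶻ + 1  ≡⟨ eq₂ (+ (n * n)) (+ triangle n) ⟩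
  + 24 *ᶻ (+ (n * n) +ᶻ + triangle n) +ᶻ + 1              ∎
  where
  eq₁ : ∀ z → (+ 6 *ᶻ z +ᶻ + 1) *ᶻ (+ 6 *ᶻ z +ᶻ + 1) ≡ + 24 *ᶻ (z *ᶻ z) +ᶻ + 12 *ᶻ (z *ᶻ (+ 1 +ᶻ z)) +ᶻ + 1
  eq₁ = solve-∀
  eq₂ : ∀ s t → + 24 *ᶻ s +ᶻ + 12 *ᶻ (+ 2 *ᶻ t) +ᶻ + 1 ≡ + 24 *ᶻ (s +ᶻ t) +ᶻ + 1
  eq₂ = solve-∀
pent-square -[1+ n ] = begin
  six -[1+ n ] *ᶻ six -[1+ n ]                            ≡⟨ eq₁ (+ n) ⟩
  + 24 *ᶻ ((+ 1 +ᶻ + n) *ᶻ (+ 1 +ᶻ + n)) +ᶻ + 12 *ᶻ (+ n *ᶻ (+ 1 +ᶻ + n)) +ᶻ + 1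
    ≡⟨ cong₂ (λ s t → + 24 *ᶻ s +ᶻ + 12 *ᶻ t +ᶻ + 1) (ℤ.pos-* (suc n) (suc n)) (triangle-doubleᶻ n) ⟨
  + 24 *ᶻ + (suc n * suc n) +ᶻ + 12 *ᶻ (+ 2 *ᶻ + triangle n) +ᶻ + 1  ≡⟨ eq₂ (+ (suc n * suc n)) (+ triangle n) ⟩
  + 24 *ᶻ (+ (suc n * suc n) +ᶻ + triangle n) +ᶻ + 1      ∎
  where
  eq₁ : ∀ z → (+ 6 *ᶻ - (+ 1 +ᶻ z) +ᶻ + 1) *ᶻ (+ 6 *ᶻ - (+ 1 +ᶻ z) +ᶻ + 1)
            ≡ + 24 *ᶻ ((+ 1 +ᶻ z) *ᶻ (+ 1 +ᶻ z)) +ᶻ + 12 *ᶻ (z *ᶻ (+ 1 +ᶻ z)) +ᶻ + 1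
  eq₁ = solve-∀
  eq₂ : ∀ s t → + 24 *ᶻ s +ᶻ + 12 *ᶻ (+ 2 *ᶻ t) +ᶻ + 1 ≡ + 24 *ᶻ (s +ᶻ t) +ᶻ + 1
  eq₂ = solve-∀

pent-large : ∀ a → ∣ a ∣ ≤ pent a
pent-large (+ zero)  = z≤n
pent-large (+ suc n) = ℕ.≤-trans (ℕ.m≤m*n (suc n) (suc n)) (ℕ.m≤m+n _ _)
pent-large -[1+ n ]  = ℕ.≤-trans (ℕ.m≤m*n (suc n) (suc n)) (ℕ.m≤m+n _ _)

-- tri a = a (2 a + 1)
tri : ℤ → ℕ
tri (+ n)    = n * suc (2 * n)
tri -[1+ n ] = suc n * suc (2 * n)

tri-square : ∀ a → four a *ᶻ four a ≡ + 8 *ᶻ + tri a +ᶻ + 1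
tri-square (+ n) = trans (eq (+ n)) (cong (λ t → + 8 *ᶻ t +ᶻ + 1) (sym (trans (ℤ.pos-* n (suc (2 * n)))
    (cong (λ t → + n *ᶻ (+ 1 +ᶻ t)) (ℤ.pos-* 2 n)))))
  where
  eq : ∀ z → (+ 4 *ᶻ z +ᶻ + 1) *ᶻ (+ 4 *ᶻ z +ᶻ + 1) ≡ + 8 *ᶻ (z *ᶻ (+ 1 +ᶻ + 2 *ᶻ z)) +ᶻ + 1
  eq = solve-∀
tri-square -[1+ n ] = trans (eq (+ n)) (cong (λ t → + 8 *ᶻ t +ᶻ + 1) (sym (trans (ℤ.pos-* (suc n) (suc (2 * n)))
    (cong (λ t → + suc n *ᶻ (+ 1 +ᶻ t)) (ℤ.pos-* 2 n)))))
  where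
  eq : ∀ z → (+ 4 *ᶻ - (+ 1 +ᶻ z) +ᶻ + 1) *ᶻ (+ 4 *ᶻ - (+ 1 +ᶻ z) +ᶻ + 1)
           ≡ + 8 *ᶻ ((+ 1 +ᶻ z) *ᶻ (+ 1 +ᶻ + 2 *ᶻ z)) +ᶻ + 1
  eq = solve-∀

tri-large : ∀ a → ∣ a ∣ ≤ tri a
tri-large (+ n)    = ℕ.m≤m*n n (suc (2 * n))
tri-large -[1+ n ] = ℕ.m≤m*n (suc n) (suc (2 * n))

Enumerates-resp : ∀ {X : Set} {f : X → ℤ} {xs M N} → M ≡ N →
                  Enumerates xs (λ x → f x ≡ M) → Enumerates xs (λ x → f x ≡ N)
Enumerates-resp refl E = E

-- The index is off by one: `reps m` belongs to N = m + 1, because 8 m + 8 = 8 N.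
reps : ℕ → List (ℤ × ℤ)
reps m = solutions tri m m

reps-enumerate : ∀ m {N} → N ≡ + suc m → Enumerates (reps m) (Four N)
reps-enumerate m refl = Enumerates-resp (eq (+ m)) (enumerates four tri 8 tri-square tri-large (ℕ.≤-refl {m}))
  where
  eq : ∀ m → + 8 *ᶻ m +ᶻ + 8 ≡ + 8 *ᶻ (+ 1 +ᶻ m)
  eq = solve-∀

pents-length : ∀ {n K} → n ≤ K → length (solutions pent K n) ≡ length (reps (3 * n))
pents-length {n} {K} n≤K = matching-length (signs (+ n))
    (Enumerates-resp (eq (+ n)) (enumerates six pent 24 pent-square pent-large n≤K))
    (reps-enumerate (3 * n) (trans (ℤ.+-comm (+ 3 *ᶻ + n) (+ 1)) (cong (+ 1 +ᶻ_) (sym (ℤ.pos-* 3 n)))))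
  where
  eq : ∀ z → + 24 *ᶻ z +ᶻ + 8 ≡ + 8 *ᶻ (+ 3 *ᶻ z +ᶻ + 1)
  eq = solve-∀

reps-halve : ∀ k → length (reps (suc (2 * k))) ≡ length (reps k)
reps-halve k = matching-length (halving (+ suc k))
  (reps-enumerate (suc (2 * k)) (trans (sym (ℤ.pos-* 2 (suc k))) (cong +_ (eq k))))
  (reps-enumerate k refl)
  where
  eq : ∀ k → 2 * suc k ≡ suc (suc (2 * k))
  eq = ℕ.solve-∀

double+1 : ∀ k → + 2 *ᶻ + k +ᶻ + 1 ≡ + suc (2 * k)
double+1 k = trans (ℤ.+-comm (+ 2 *ᶻ + k) (+ 1)) (cong (+ 1 +ᶻ_) (sym (ℤ.pos-* 2 k)))

reps-even : ∀ k → (∀ u → u * u ≢ suc (2 * k)) → (∀ u → 7 * (u * u) ≢ suc (2 * k)) →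
            parity (length (reps (2 * k))) ≡ false
reps-even k □ 7□ = pairing-even
  (flipping (+ k)
    (λ u eq → □ ∣ u ∣ (trans (sym (ℤ.abs-* u u)) (cong ∣_∣ (trans eq (double+1 k)))))
    (λ u eq → 7□ ∣ u ∣ (trans (cong (7 *_) (sym (ℤ.abs-* u u)))
                       (trans (sym (ℤ.abs-* (+ 7) (u *ᶻ u))) (cong ∣_∣ (trans eq (double+1 k)))))))
  (reps-enumerate (2 * k) (double+1 k))

reps-empty : ∀ m → (∀ x y → x * x + 7 * (y * y) ≢ 8 * suc m) → parity (length (reps m)) ≡ false
reps-empty m none with reps m in eq
... | [] = refl
... | (a , b) ∷ _ = ⊥-elim (none ∣ four a ∣ ∣ four b ∣ (ℤ.+-injective (begin
    + (x * x) +ᶻ + (7 * (y * y))          ≡⟨ cong (+ (x * x) +ᶻ_) (ℤ.pos-* 7 (y * y)) ⟩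
    + (x * x) +ᶻ + 7 *ᶻ + (y * y)         ≡⟨ cong₂ (λ s t → s +ᶻ + 7 *ᶻ t) (square (four a)) (square (four b)) ⟩
    form (four a) (four b)                ≡⟨ Enumerates.sound (reps-enumerate m refl) (subst ((a , b) ∈_) (sym eq) (here refl)) ⟩
    + 8 *ᶻ + suc m                        ≡⟨ ℤ.pos-* 8 (suc m) ⟨
    + (8 * suc m)                         ∎)))
  where
  x = ∣ four a ∣
  y = ∣ four b ∣
  square : ∀ z → + (∣ z ∣ * ∣ z ∣) ≡ z *ᶻ z
  square (+ n)    = ℤ.pos-* n n
  square -[1+ n ] = refl

-- The coefficients of f₁ f₇

coeff : ℕ → Bool
coeff n = parity (length (reps (3 * n)))

∑-cong : ∀ {X : Set} {f g : X → BSeries} {m} → (∀ x → f x m ≡ g x m) → ∀ xs → ∑ f xs m ≡ ∑ g xs m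
∑-cong eq []       = refl
∑-cong eq (x ∷ xs) = cong₂ _xor_ (eq x) (∑-cong eq xs)

∑-++ : ∀ {X : Set} (f : X → BSeries) xs ys → ∑ f (xs ++ ys) ≗ ∑ f xs ⊕ ∑ f ys
∑-++ f []       ys m = refl
∑-++ f (x ∷ xs) ys m = trans (cong (f x m xor_) (∑-++ f xs ys m)) (sym (xor-assoc (f x m) _ _))

∑-map : ∀ {X Y : Set} (f : Y → BSeries) (h : X → Y) xs → ∑ f (map h xs) ≗ ∑ (λ x → f (h x)) xs
∑-map f h []       m = refl
∑-map f h (x ∷ xs) m = cong (f (h x) m xor_) (∑-map f h xs m)

∑-cartesianProduct : ∀ {X Y : Set} (f : X × Y → BSeries) xs ys →
                     ∑ f (cartesianProduct xs ys) ≗ ∑ (λ x → ∑ (λ y → f (x , y)) ys) xs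
∑-cartesianProduct f []       ys m = refl
∑-cartesianProduct f (x ∷ xs) ys m = trans (∑-++ f (map (x ,_) ys) _ m)
  (cong₂ _xor_ (∑-map f (x ,_) ys m) (∑-cartesianProduct f xs ys m))

shift-∑ : ∀ {X : Set} k (f : X → BSeries) xs → shift k (∑ f xs) ≗ ∑ (λ x → shift k (f x)) xs
shift-∑ k f []       m = shift-zero k m
shift-∑ k f (x ∷ xs) m = trans (shift-⊕ k (f x) (∑ f xs) m) (cong (shift k (f x) m xor_) (shift-∑ k f xs m))

multiples-∑ : ∀ {X : Set} e n (f : X → BSeries) xs → multiples e n (∑ f xs) ≗ ∑ (λ x → multiples e n (f x)) xs
multiples-∑ e n f []       m = multiples-zero e n m
multiples-∑ e n f (x ∷ xs) m = trans (multiples-⊕ e n (f x) (∑ f xs) m)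
                                     (cong (multiples e n (f x) m xor_) (multiples-∑ e n f xs m))

parity-filter : ∀ {X : Set} {P : X → Set} (P? : Decidable P) (f : X → BSeries) {m} →
                (∀ x → f x m ≡ does (P? x)) → ∀ xs → ∑ f xs m ≡ parity (length (filter P? xs))
parity-filter P? f eq []       = refl
parity-filter P? f eq (x ∷ xs) rewrite eq x with does (P? x)
... | true  = cong not (parity-filter P? f eq xs)
... | false = parity-filter P? f eq xs

theta : ℕ → BSeries
theta K = multiples 7 K (multiples 1 K oneᵇ)

-- The pentagonal number theorem in q and in q^7 turns the product into the sum of q^(pent a + 7
-- pent b) over a box; its coefficient modulo 2 is the parity of the number of pairs with exponent
-- m, and 24 m + 8 = 8 (3 m + 1).
theta-coeff : ∀ {K m} → m ≤ K → theta K m ≡ coeff m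
theta-coeff {K} {m} m≤K = begin
  theta K m
    ≡⟨ multiples-cong≤ 7 K (pentagonal 1 K (s≤s z≤n)) m m≤K ⟩
  multiples 7 K (∑ (λ a → shift (1 * pent a) oneᵇ) (ball K)) m
    ≡⟨ multiples-∑ 7 K _ (ball K) m ⟩
  ∑ (λ a → multiples 7 K (shift (1 * pent a) oneᵇ)) (ball K) m
    ≡⟨ ∑-cong inner (ball K) ⟩
  ∑ (λ a → ∑ (λ b → shift (1 * pent a) (shift (7 * pent b) oneᵇ)) (ball K)) (ball K) m
    ≡⟨ ∑-cartesianProduct term (ball K) (ball K) m ⟨
  ∑ term (cartesianProduct (ball K) (ball K)) m
    ≡⟨ parity-filter (λ (a , b) → pent a + 7 * pent b ℕ.≟ m) term indicator (cartesianProduct (ball K) (ball K)) ⟩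
  parity (length (solutions pent K m))
    ≡⟨ cong parity (pents-length m≤K) ⟩
  coeff m ∎
  where
  term : ℤ × ℤ → BSeries
  term (a , b) = shift (1 * pent a) (shift (7 * pent b) oneᵇ)
  inner : ∀ a → multiples 7 K (shift (1 * pent a) oneᵇ) m
              ≡ ∑ (λ b → shift (1 * pent a) (shift (7 * pent b) oneᵇ)) (ball K) m
  inner a = trans (multiples-shift 7 K (1 * pent a) oneᵇ m)
           (trans (shift-cong≤ (1 * pent a) (pentagonal 7 K (s≤s z≤n)) m m≤K)
                  (shift-∑ (1 * pent a) (λ b → shift (7 * pent b) oneᵇ) (ball K) m))
  indicator : ∀ x → term x m ≡ does (pent (proj₁ x) + 7 * pent (proj₂ x) ℕ.≟ m)
  indicator (a , b) = begin
    term (a , b) m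
      ≡⟨ shift-+ (1 * pent a) (7 * pent b) oneᵇ m ⟨
    shift (1 * pent a + 7 * pent b) oneᵇ m
      ≡⟨ shift-≡ oneᵇ (cong (_+ 7 * pent b) (ℕ.*-identityˡ (pent a))) m ⟩
    shift (pent a + 7 * pent b) oneᵇ m
      ≡⟨ shift-one (pent a + 7 * pent b) m ⟩
    (pent a + 7 * pent b ≡ᵇ m) ∎

-- The residues are checked by evaluation: for numerals k, c and r the implicit argument is found by
-- running the decision procedure.
square-residue : ∀ k .{{_ : NonZero k}} c r {_ : True (all? λ (i : Fin k) → ¬? ((c * (toℕ i * toℕ i)) % k ℕ.≟ r))} →
                 ∀ u → (c * (u * u)) % k ≢ r
square-residue k c r {ok} u eq = toWitness ok (fromℕ< (m%n<n u k)) (begin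
  (c * (toℕ i * toℕ i)) % k                ≡⟨ cong (λ i → (c * (i * i)) % k) (toℕ-fromℕ< (m%n<n u k)) ⟩
  (c * (u % k * (u % k))) % k              ≡⟨ %-distribˡ-* c (u % k * (u % k)) k ⟩
  (c % k * ((u % k * (u % k)) % k)) % k    ≡⟨ cong (λ t → (c % k * t) % k) (%-distribˡ-* u u k) ⟨
  (c % k * ((u * u) % k)) % k              ≡⟨ %-distribˡ-* c (u * u) k ⟨
  (c * (u * u)) % k                        ≡⟨ eq ⟩
  r                                        ∎)
  where i = fromℕ< (m%n<n u k)

reps-even-residue : ∀ k m r q .{{_ : NonZero m}} → suc (2 * k) ≡ r + q * m →
                    {_ : True (all? λ (i : Fin m) → ¬? ((1 * (toℕ i * toℕ i)) % m ℕ.≟ r % m))} →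
                    {_ : True (all? λ (i : Fin m) → ¬? ((7 * (toℕ i * toℕ i)) % m ℕ.≟ r % m))} →
                    parity (length (reps (2 * k))) ≡ false
reps-even-residue k m r q eq {□} {7□} = reps-even k
  (λ u p → square-residue m 1 (r % m) {□} u (residue (trans (ℕ.*-identityˡ (u * u)) p)))
  (λ u p → square-residue m 7 (r % m) {7□} u (residue p))
  where
  residue : ∀ {t} → t ≡ suc (2 * k) → t % m ≡ r % m
  residue p = trans (cong (_% m) (trans p eq)) ([m+kn]%n≡m%n r q m)

-- Here 3 (4 n + 1) + 1 = 4 (3 n + 1), so two halvings of N suffice.
coeff-4n+1 : ∀ n → coeff (suc (2 * (2 * n))) ≡ coeff n
coeff-4n+1 n = trans (cong (λ k → parity (length (reps k))) (eq n))
  (cong parity (trans (reps-halve (suc (2 * (3 * n)))) (reps-halve (3 * n))))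
  where
  eq : ∀ n → 3 * suc (2 * (2 * n)) ≡ suc (2 * suc (2 * (3 * n)))
  eq = ℕ.solve-∀

-- Here N = 12 n + 10 = 2 (6 n + 5), and after one halving 6 n + 5 ≡ 2 modulo 3 is neither a square
-- nor 7 times a square.
coeff-4n+3 : ∀ n → coeff (suc (2 * suc (2 * n))) ≡ false
coeff-4n+3 n = trans (cong (λ k → parity (length (reps k))) (eq₁ n))
  (trans (cong parity (reps-halve (2 * (3 * n + 2)))) (reps-even-residue (3 * n + 2) 3 5 (2 * n) (eq₂ n)))
  where
  eq₁ : ∀ n → 3 * suc (2 * suc (2 * n)) ≡ suc (2 * (2 * (3 * n + 2)))
  eq₁ = ℕ.solve-∀
  eq₂ : ∀ n → suc (2 * (3 * n + 2)) ≡ 5 + 2 * n * 3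
  eq₂ = ℕ.solve-∀

-- Here N = 24 n + 13 ≡ 5 modulo 8, and in `coeff-8n+6` N = 24 n + 19 ≡ 3. An odd square is 1 modulo
-- 8, and 7 times an odd square is 7.
coeff-8n+4 : ∀ n → coeff (8 * n + 4) ≡ false
coeff-8n+4 n = trans (cong (λ k → parity (length (reps k))) (eq₁ n)) (reps-even-residue (12 * n + 6) 8 13 (3 * n) (eq₂ n))
  where
  eq₁ : ∀ n → 3 * (8 * n + 4) ≡ 2 * (12 * n + 6)
  eq₁ = ℕ.solve-∀
  eq₂ : ∀ n → suc (2 * (12 * n + 6)) ≡ 13 + 3 * n * 8
  eq₂ = ℕ.solve-∀

coeff-8n+6 : ∀ n → coeff (8 * n + 6) ≡ false
coeff-8n+6 n = trans (cong (λ k → parity (length (reps k))) (eq₁ n)) (reps-even-residue (12 * n + 9) 8 19 (3 * n) (eq₂ n))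
  where
  eq₁ : ∀ n → 3 * (8 * n + 6) ≡ 2 * (12 * n + 9)
  eq₁ = ℕ.solve-∀
  eq₂ : ∀ n → suc (2 * (12 * n + 9)) ≡ 19 + 3 * n * 8
  eq₂ = ℕ.solve-∀

-- Reduction of A₇ modulo 2

oddMultiples-cong : ∀ e n {c d} → c ≗ d → oddMultiples e n c ≗ oddMultiples e n d
oddMultiples-cong e zero    eq = eq
oddMultiples-cong e (suc n) eq = mul-cong (e * suc (2 * n)) (oddMultiples-cong e n eq)

oddMultiples-mul : ∀ e n f c → oddMultiples e n (mul f c) ≗ mul f (oddMultiples e n c)
oddMultiples-mul e zero    f c m = refl
oddMultiples-mul e (suc n) f c m = trans (mul-cong (e * suc (2 * n)) (oddMultiples-mul e n f c) m)
                                         (mul-comm (e * suc (2 * n)) f (oddMultiples e n c) m)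

oddMultiples-multiples : ∀ e n f k c → oddMultiples e n (multiples f k c) ≗ multiples f k (oddMultiples e n c)
oddMultiples-multiples e n f zero    c m = refl
oddMultiples-multiples e n f (suc k) c m = trans (oddMultiples-mul e n (f * suc k) (multiples f k c) m)
                                                 (mul-cong (f * suc k) (oddMultiples-multiples e n f k c) m)

oddProduct : ℕ → BSeries
oddProduct K = oddMultiples 7 K (oddMultiples 1 K oneᵇ)

theta-split : ∀ K → theta (2 * K) ≗ multiples 14 K (multiples 2 K (oddProduct K))
theta-split K m = begin
  multiples 7 (2 * K) (multiples 1 (2 * K) oneᵇ) m
    ≡⟨ multiples-split 7 K (multiples 1 (2 * K) oneᵇ) m ⟩
  multiples 14 K (oddMultiples 7 K (multiples 1 (2 * K) oneᵇ)) m
    ≡⟨ multiples-cong 14 K (oddMultiples-cong 7 K (multiples-split 1 K oneᵇ)) m ⟩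
  multiples 14 K (oddMultiples 7 K (multiples 2 K (oddMultiples 1 K oneᵇ))) m
    ≡⟨ multiples-cong 14 K (oddMultiples-multiples 7 K 2 K (oddMultiples 1 K oneᵇ)) m ⟩
  multiples 14 K (multiples 2 K (oddProduct K)) m ∎

theta-square : ∀ K → multiples 7 K (multiples 1 K (theta K)) ≗ multiples 14 K (multiples 2 K oneᵇ)
theta-square K m = begin
  multiples 7 K (multiples 1 K (multiples 7 K (multiples 1 K oneᵇ))) m
    ≡⟨ multiples-cong 7 K (multiples-comm 1 K 7 K (multiples 1 K oneᵇ)) m ⟩
  multiples 7 K (multiples 7 K (multiples 1 K (multiples 1 K oneᵇ))) m
    ≡⟨ multiples-square 7 K (multiples 1 K (multiples 1 K oneᵇ)) m ⟩
  multiples 14 K (multiples 1 K (multiples 1 K oneᵇ)) m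
    ≡⟨ multiples-cong 14 K (multiples-square 1 K oneᵇ) m ⟩
  multiples 14 K (multiples 2 K oneᵇ) m ∎

even⊎odd : ∀ m → ∃ λ i → m ≡ 2 * i ⊎ m ≡ suc (2 * i)
even⊎odd zero    = 0 , inj₁ refl
even⊎odd (suc m) with even⊎odd m
... | i , inj₁ refl = i , inj₂ refl
... | i , inj₂ refl = suc i , inj₁ (eq i)
  where
  eq : ∀ i → suc (suc (2 * i)) ≡ 2 * suc i
  eq = ℕ.solve-∀

-- The right side is F(q²), which has even exponents only: for m = 2 i the claim is c(4 i + 1) =
-- c(i), for odd m it is the vanishing of c(4 i + 3).
oddPart-theta : ∀ {K m} → suc (2 * m) ≤ K → theta (2 * K) (suc (2 * m)) ≡ multiples 14 K (multiples 2 K oneᵇ) m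
oddPart-theta {K} {m} m≤K with even⊎odd m
... | i , inj₁ refl = begin
  theta (2 * K) (suc (2 * (2 * i)))                   ≡⟨ theta-coeff (ℕ.≤-trans m≤K (ℕ.m≤n*m K 2)) ⟩
  coeff (suc (2 * (2 * i)))                           ≡⟨ coeff-4n+1 i ⟩
  coeff i                                             ≡⟨ theta-coeff i≤K ⟨
  multiples 7 K (multiples 1 K oneᵇ) i
    ≡⟨ multiples-cong 7 K (multiples-cong 1 K evenPart-one) i ⟨
  multiples 7 K (multiples 1 K (evenPart oneᵇ)) i
    ≡⟨ multiples-cong 7 K (evenPart-multiples 1 K oneᵇ) i ⟨
  multiples 7 K (evenPart (multiples 2 K oneᵇ)) i
    ≡⟨ evenPart-multiples 7 K (multiples 2 K oneᵇ) i ⟨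
  multiples 14 K (multiples 2 K oneᵇ) (2 * i) ∎
  where
  i≤K : i ≤ K
  i≤K = ℕ.≤-trans (ℕ.m≤n*m i 2) (ℕ.≤-trans (ℕ.m≤n*m (2 * i) 2) (ℕ.≤-trans (ℕ.n≤1+n _) m≤K))
... | i , inj₂ refl = begin
  theta (2 * K) (suc (2 * suc (2 * i)))               ≡⟨ theta-coeff (ℕ.≤-trans m≤K (ℕ.m≤n*m K 2)) ⟩
  coeff (suc (2 * suc (2 * i)))                       ≡⟨ coeff-4n+3 i ⟩
  false                                               ≡⟨ multiples-zero 7 K i ⟨
  multiples 7 K zeroᵇ i                               ≡⟨ multiples-cong 7 K (multiples-zero 1 K) i ⟨
  multiples 7 K (multiples 1 K zeroᵇ) i
    ≡⟨ multiples-cong 7 K (oddPart-multiples 1 K oneᵇ) i ⟨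
  multiples 7 K (oddPart (multiples 2 K oneᵇ)) i
    ≡⟨ oddPart-multiples 7 K (multiples 2 K oneᵇ) i ⟨
  multiples 14 K (multiples 2 K oneᵇ) (suc (2 * i)) ∎

-- With F = f₁ f₇, the product D satisfies D(q) F(q²) = F(q), while oddPart F = F² by
-- oddPart-theta; taking odd parts, (oddPart D) F = F², and F can be cancelled.
oddPart-oddProduct : ∀ n → oddPart (oddProduct (suc (2 * n))) n ≡ coeff n
oddPart-oddProduct n = trans
  (multiples-injective 1 K (s≤s z≤n) (multiples-injective 7 K (s≤s z≤n) product) n ℕ.≤-refl)
  (theta-coeff (ℕ.≤-trans (ℕ.m≤n*m n 2) (ℕ.n≤1+n _)))
  where
  -- This length is forced: `A 7 (suc (2 * n))` is by definition a coefficient of the product with 2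
  -- n + 1 factors of each kind.
  K = suc (2 * n)
  D = oddProduct K
  product : multiples 7 K (multiples 1 K (oddPart D)) ≈[ n ] multiples 7 K (multiples 1 K (theta K))
  product m m≤n = begin
    multiples 7 K (multiples 1 K (oddPart D)) m       ≡⟨ multiples-cong 7 K (oddPart-multiples 1 K D) m ⟨
    multiples 7 K (oddPart (multiples 2 K D)) m       ≡⟨ oddPart-multiples 7 K (multiples 2 K D) m ⟨
    multiples 14 K (multiples 2 K D) (suc (2 * m))    ≡⟨ theta-split K (suc (2 * m)) ⟨
    theta (2 * K) (suc (2 * m))                       ≡⟨ oddPart-theta (s≤s (ℕ.*-monoʳ-≤ 2 m≤n)) ⟩
    multiples 14 K (multiples 2 K oneᵇ) m             ≡⟨ theta-square K m ⟨
    multiples 7 K (multiples 1 K (theta K)) m         ∎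

mod₂ : Series → BSeries
mod₂ c m = parity ∣ c m ∣

parity-+ : ∀ m n → parity (m + n) ≡ parity m xor parity n
parity-+ zero    n = refl
parity-+ (suc m) n = trans (cong not (parity-+ m n)) (not-xor (parity m) (parity n))
  where
  not-xor : ∀ a b → not (a xor b) ≡ not a xor b
  not-xor true  b = not-involutive b
  not-xor false b = refl

parity-⊖ : ∀ m n → parity ∣ m ℤ.⊖ n ∣ ≡ parity m xor parity n
parity-⊖ m       zero    = sym (xor-identityʳ (parity m))
parity-⊖ zero    (suc n) = refl
parity-⊖ (suc m) (suc n) = begin
  parity ∣ suc m ℤ.⊖ suc n ∣           ≡⟨ cong (λ z → parity ∣ z ∣) (ℤ.[1+m]⊖[1+n]≡m⊖n m n) ⟩
  parity ∣ m ℤ.⊖ n ∣                   ≡⟨ parity-⊖ m n ⟩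
  parity m xor parity n                ≡⟨ xor-annihilates-not (parity m) (parity n) ⟨
  not (parity m) xor not (parity n)    ∎

parity-- : ∀ x y → parity ∣ x -ᶻ y ∣ ≡ parity ∣ x ∣ xor parity ∣ y ∣
parity-- x y = trans (parity-∣+∣ x (- y)) (cong (λ n → parity ∣ x ∣ xor parity n) (ℤ.∣-i∣≡∣i∣ y))
  where
  parity-∣+∣ : ∀ x y → parity ∣ x +ᶻ y ∣ ≡ parity ∣ x ∣ xor parity ∣ y ∣
  parity-∣+∣ (+ m)    (+ n)    = parity-+ m n
  parity-∣+∣ (+ m)    -[1+ n ] = parity-⊖ m (suc n)
  parity-∣+∣ -[1+ m ] (+ n)    = trans (parity-⊖ n (suc m)) (xor-comm (parity n) (parity (suc m)))
  parity-∣+∣ -[1+ m ] -[1+ n ] = trans (cong parity (cong suc (sym (ℕ.+-suc m n)))) (parity-+ (suc m) (suc n))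

shift-if : ∀ e c m → shift e c m ≡ (if m <ᵇ e then false else c (m ∸ e))
shift-if zero    c m       = refl
shift-if (suc e) c zero    = refl
shift-if (suc e) c (suc m) = shift-if e c m

mod₂-mulFactor : ∀ e c → mod₂ (mulFactor e c) ≗ mul e (mod₂ c)
mod₂-mulFactor e c m rewrite shift-if e (mod₂ c) m with m <ᵇ e
... | true  = sym (xor-identityʳ _)
... | false = parity-- (c m) (c (m ∸ e))

mod₂-one : mod₂ one ≗ oneᵇ
mod₂-one zero    = refl
mod₂-one (suc m) = refl

mod₂-prodSeries : ∀ i → mod₂ (prodSeries 7 i) ≗ oddProduct i
mod₂-prodSeries zero    m = mod₂-one m
mod₂-prodSeries (suc i) m = begin
  mod₂ (mulFactor e (mulFactor (7 * e) (prodSeries 7 i))) m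
    ≡⟨ mod₂-mulFactor e (mulFactor (7 * e) (prodSeries 7 i)) m ⟩
  mul e (mod₂ (mulFactor (7 * e) (prodSeries 7 i))) m
    ≡⟨ mul-cong e (mod₂-mulFactor (7 * e) (prodSeries 7 i)) m ⟩
  mul e (mul (7 * e) (mod₂ (prodSeries 7 i))) m
    ≡⟨ mul-cong e (mul-cong (7 * e) (mod₂-prodSeries i)) m ⟩
  mul e (mul (7 * e) (oddProduct i)) m
    ≡⟨ mul-comm e (7 * e) (oddProduct i) m ⟩
  mul (7 * e) (mul e (oddProduct i)) m
    ≡⟨ mul-cong (7 * e) (mul-≡ (oddProduct i) (sym (ℕ.*-identityˡ e))) m ⟩
  mul (7 * e) (mul (1 * e) (oddProduct i)) m
    ≡⟨ mul-cong (7 * e) (oddMultiples-mul 7 i (1 * e) (oddMultiples 1 i oneᵇ)) m ⟨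
  oddProduct (suc i) m ∎
  where e = suc (2 * i)

A-odd : ∀ n → parity ∣ A 7 (suc (2 * n)) ∣ ≡ coeff n
A-odd n = trans (mod₂-prodSeries (suc (2 * n)) (suc (2 * n))) (oddPart-oddProduct n)

parity⇒2∣ : ∀ n → parity n ≡ false → 2 ℕ.∣ n
parity⇒2∣ zero          _  = ℕ.divides 0 refl
parity⇒2∣ (suc (suc n)) eq = ℕ.∣m∣n⇒∣m+n (ℕ.divides 1 refl) (parity⇒2∣ n (trans (sym (not-involutive _)) eq))

A-even : ∀ {k} n → k ≡ suc (2 * n) → coeff n ≡ false → + 2 ∣ A 7 k
A-even n refl eq = parity⇒2∣ _ (trans (A-odd n) eq)

-- Non-representability by descent

7-prime : Prime 7
7-prime = from-yes (prime? 7)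

p∣square : ∀ {p x} → Prime p → p ℕ.∣ x * x → p ℕ.∣ x
p∣square {x = x} pr p∣ with euclidsLemma x x pr p∣
... | inj₁ q = q
... | inj₂ q = q

-- Descent at the ramified prime: for positive α, 7 divides x = 7 z, and division by 7 leaves y² + 7
-- z² with the roles of the coordinates exchanged. At α = 0 the equation makes t a square modulo 7.
no-rep-7 : ∀ α t → (∀ u → (1 * (u * u)) % 7 ≢ t % 7) → ∀ x y → x * x + 7 * (y * y) ≢ 7 ^ α * t
no-rep-7 zero t nonresidue x y eq = nonresidue x (begin
  (1 * (x * x)) % 7            ≡⟨ cong (_% 7) (ℕ.*-identityˡ (x * x)) ⟩
  (x * x) % 7                  ≡⟨ [m+kn]%n≡m%n (x * x) (y * y) 7 ⟨
  (x * x + y * y * 7) % 7      ≡⟨ cong (λ s → (x * x + s) % 7) (ℕ.*-comm (y * y) 7) ⟩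
  (x * x + 7 * (y * y)) % 7    ≡⟨ cong (_% 7) (trans eq (ℕ.*-identityˡ t)) ⟩
  t % 7                        ∎)
no-rep-7 (suc α) t nonresidue x y eq with p∣square {x = x} 7-prime (ℕ.∣m+n∣m⇒∣n 7∣ (ℕ.m∣m*n (y * y)))
  where
  7∣ : 7 ℕ.∣ 7 * (y * y) + x * x
  7∣ = subst (7 ℕ.∣_) (trans (sym (trans eq (ℕ.*-assoc 7 (7 ^ α) t))) (ℕ.+-comm (x * x) _)) (ℕ.m∣m*n (7 ^ α * t))
... | ℕ.divides z refl = no-rep-7 α t nonresidue y z
  (ℕ.*-cancelˡ-≡ _ _ 7 (trans (identity y z) (trans eq (ℕ.*-assoc 7 (7 ^ α) t))))
  where
  identity : ∀ y z → 7 * (y * y + 7 * (z * z)) ≡ z * 7 * (z * 7) + 7 * (y * y)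
  identity = ℕ.solve-∀

module _ {p} (pr : Prime p) (legendre : LegendreMinusOne (- (+ 7)) p) where

  private instance
    p-nonZero : NonZero p
    p-nonZero = prime⇒nonZero pr

  not∣z²+7 : ∀ z → ¬ p ℕ.∣ z * z + 7
  not∣z²+7 z p∣ = proj₂ legendre (+ z , subst (p ℕ.∣_) (cong (λ s → ∣ s +ᶻ + 7 ∣) (ℤ.pos-* z z)) p∣)

  ∤⇒coprime : ∀ {y} → ¬ p ℕ.∣ y → Coprime p y
  ∤⇒coprime p∤y (d∣p , d∣y) with prime⇒irreducible pr d∣p
  ... | inj₁ d≡1  = d≡1
  ... | inj₂ refl = ⊥-elim (p∤y d∣y)

  -- If s inverts ± y modulo p, then (x s)² ≡ -7.
  p∣y : ∀ {x y} → p ℕ.∣ x * x + 7 * (y * y) → p ℕ.∣ y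
  p∣y {x} {y} p∣ with p ℕ.∣? y
  ... | yes q  = q
  ... | no p∤y with coprime-Bézout (∤⇒coprime p∤y)
  ...   | Bézout.+- a s eq = ⊥-elim (not∣z²+7 (x * s) (ℕ.∣m+n∣m⇒∣n
            (subst (p ℕ.∣_) (sym identity)
              (ℕ.∣m∣n⇒∣m+n (ℕ.∣n⇒∣m*n (s * s) p∣) (ℕ.∣n⇒∣m*n 7 (ℕ.divides a refl))))
            (ℕ.∣n⇒∣m*n (7 * (s * y)) (ℕ.divides a refl))))
    where
    ring : ∀ x y s → 7 * (s * y) * (1 + s * y) + (x * s * (x * s) + 7)
                   ≡ s * s * (x * x + 7 * (y * y)) + 7 * (1 + s * y)
    ring = ℕ.solve-∀
    identity : 7 * (s * y) * (a * p) + (x * s * (x * s) + 7) ≡ s * s * (x * x + 7 * (y * y)) + 7 * (a * p)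
    identity = subst (λ t → 7 * (s * y) * t + (x * s * (x * s) + 7) ≡ s * s * (x * x + 7 * (y * y)) + 7 * t)
                     eq (ring x y s)
  ...   | Bézout.-+ a s eq = ⊥-elim (not∣z²+7 (x * s) (ℕ.∣m+n∣m⇒∣n
            (subst (p ℕ.∣_) identity (ℕ.∣n⇒∣m*n (s * s) p∣))
            (ℕ.∣n⇒∣m*n (7 * (a * p + 2)) (ℕ.divides a refl))))
    where
    ring₁ : ∀ x y s → s * s * (x * x + 7 * (y * y)) ≡ x * s * (x * s) + 7 * (s * y * (s * y))
    ring₁ = ℕ.solve-∀
    ring₂ : ∀ u t → u + 7 * ((1 + t) * (1 + t)) ≡ 7 * (t + 2) * t + (u + 7)
    ring₂ = ℕ.solve-∀
    identity : s * s * (x * x + 7 * (y * y)) ≡ 7 * (a * p + 2) * (a * p) + (x * s * (x * s) + 7)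
    identity = trans (ring₁ x y s)
      (trans (cong (λ t → x * s * (x * s) + 7 * (t * t)) (sym eq)) (ring₂ (x * s * (x * s)) (a * p)))

  -- Such a p is inert: if it divides the form it divides both x and y, so p² splits off. Descent by
  -- p² thus never exhausts an odd exponent.
  no-rep : ∀ β w → ¬ p ℕ.∣ w → ∀ x y → x * x + 7 * (y * y) ≢ p ^ (2 * β + 1) * w
  no-rep β w p∤w x y eq = descend β eq
    where
    p∣N : ∀ e → p ℕ.∣ p ^ (e + 1) * w
    p∣N e = ℕ.∣m⇒∣m*n w (subst (λ k → p ℕ.∣ p ^ k) (ℕ.+-comm 1 e) (ℕ.m∣m*n (p ^ e)))
    p∣x : p ℕ.∣ x * x + 7 * (y * y) → p ℕ.∣ x
    p∣x p∣ = p∣square pr (ℕ.∣m+n∣m⇒∣n (subst (p ℕ.∣_) (ℕ.+-comm (x * x) _) p∣)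
                                       (ℕ.∣n⇒∣m*n 7 (ℕ.∣m⇒∣m*n y (p∣y {x} {y} p∣))))
    descend : ∀ β → x * x + 7 * (y * y) ≢ p ^ (2 * β + 1) * w
    descend β eq with subst (p ℕ.∣_) (sym eq) (p∣N (2 * β))
    ... | p∣ with p∣x p∣ | p∣y {x} {y} p∣
    descend zero eq | p∣ | ℕ.divides x′ refl | ℕ.divides y′ refl =
      p∤w (ℕ.divides (x′ * x′ + 7 * (y′ * y′)) (ℕ.*-cancelˡ-≡ _ _ p (begin
        p * w                                            ≡⟨ cong (_* w) (ℕ.*-identityʳ p) ⟨
        p * 1 * w                                        ≡⟨ eq ⟨
        x′ * p * (x′ * p) + 7 * (y′ * p * (y′ * p))      ≡⟨ identity p x′ y′ ⟩
        p * ((x′ * x′ + 7 * (y′ * y′)) * p)              ∎)))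
      where
      identity : ∀ p x y → x * p * (x * p) + 7 * (y * p * (y * p)) ≡ p * ((x * x + 7 * (y * y)) * p)
      identity = ℕ.solve-∀
    descend (suc β) eq | p∣ | ℕ.divides x′ refl | ℕ.divides y′ refl =
      no-rep β w p∤w x′ y′ (ℕ.*-cancelˡ-≡ _ _ p (ℕ.*-cancelˡ-≡ _ _ p (begin
        p * (p * (x′ * x′ + 7 * (y′ * y′)))              ≡⟨ identity p x′ y′ ⟩
        x′ * p * (x′ * p) + 7 * (y′ * p * (y′ * p))      ≡⟨ eq ⟩
        p ^ (2 * suc β + 1) * w                          ≡⟨ cong (λ k → p ^ k * w) (exponent β) ⟩
        p * (p * p ^ (2 * β + 1)) * w                    ≡⟨ assoc p (p ^ (2 * β + 1)) w ⟩
        p * (p * (p ^ (2 * β + 1) * w))                  ∎)))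
      where
      identity : ∀ p x y → p * (p * (x * x + 7 * (y * y))) ≡ x * p * (x * p) + 7 * (y * p * (y * p))
      identity = ℕ.solve-∀
      exponent : ∀ β → 2 * suc β + 1 ≡ suc (suc (2 * β + 1))
      exponent = ℕ.solve-∀
      assoc : ∀ p s w → p * (p * s) * w ≡ p * (p * (s * w))
      assoc = ℕ.solve-∀

-- The arithmetic progressions and the five congruences

index : ∀ X W {B} q → B ≡ suc (3 * q) → 2 * X * W + (2 * B + 1) / 3 ≡ suc (2 * (X * W + q))
index X W q refl = begin
  2 * X * W + (2 * suc (3 * q) + 1) / 3   ≡⟨ cong (λ t → 2 * X * W + t / 3) (eq₁ q) ⟩
  2 * X * W + suc (2 * q) * 3 / 3         ≡⟨ cong (_+_ (2 * X * W)) (m*n/n≡m (suc (2 * q)) 3) ⟩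
  2 * X * W + suc (2 * q)                 ≡⟨ eq₂ X W q ⟩
  suc (2 * (X * W + q))                   ∎
  where
  eq₁ : ∀ q → 2 * suc (3 * q) + 1 ≡ suc (2 * q) * 3
  eq₁ = ℕ.solve-∀
  eq₂ : ∀ X W q → 2 * X * W + suc (2 * q) ≡ suc (2 * (X * W + q))
  eq₂ = ℕ.solve-∀

-- The offset (2 B + 1)/3 in the progressions is designed for this: with n = X W + q, the number N =
-- 3 n + 1 becomes 3 X W + B, from which a power of 7 or p can be factored out when X divides B.
index-form : ∀ X W {B} q → B ≡ suc (3 * q) → 8 * suc (3 * (X * W + q)) ≡ 8 * (3 * (X * W) + B)
index-form X W q refl = eq (X * W) q
  where
  eq : ∀ t q → 8 * suc (3 * (t + q)) ≡ 8 * (3 * t + suc (3 * q))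
  eq = ℕ.solve-∀

1mod3-* : ∀ {a b} → (∃ λ q → a ≡ suc (3 * q)) → (∃ λ q → b ≡ suc (3 * q)) → ∃ λ q → a * b ≡ suc (3 * q)
1mod3-* (q , refl) (r , refl) = 3 * q * r + q + r , eq q r
  where
  eq : ∀ q r → suc (3 * q) * suc (3 * r) ≡ suc (3 * (3 * q * r + q + r))
  eq = ℕ.solve-∀

7^-1mod3 : ∀ α → ∃ λ q → 7 ^ α ≡ suc (3 * q)
7^-1mod3 zero    = 0 , refl
7^-1mod3 (suc α) = 1mod3-* (2 , refl) (7^-1mod3 α)

part-i : ∀ n → + 2 ∣ (A 7 (2 * n + 1) ℤ.- A 7 (8 * n + 3))
part-i n = parity⇒2∣ _ (begin
  parity ∣ A 7 (2 * n + 1) -ᶻ A 7 (8 * n + 3) ∣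
    ≡⟨ parity-- (A 7 (2 * n + 1)) (A 7 (8 * n + 3)) ⟩
  parity ∣ A 7 (2 * n + 1) ∣ xor parity ∣ A 7 (8 * n + 3) ∣
    ≡⟨ cong₂ (λ k l → parity ∣ A 7 k ∣ xor parity ∣ A 7 l ∣) (eq₁ n) (eq₂ n) ⟩
  parity ∣ A 7 (suc (2 * n)) ∣ xor parity ∣ A 7 (suc (2 * suc (2 * (2 * n)))) ∣
    ≡⟨ cong₂ _xor_ (A-odd n) (trans (A-odd (suc (2 * (2 * n)))) (coeff-4n+1 n)) ⟩
  coeff n xor coeff n
    ≡⟨ xor-same (coeff n) ⟩
  false ∎)
  where
  eq₁ : ∀ n → 2 * n + 1 ≡ suc (2 * n)
  eq₁ = ℕ.solve-∀
  eq₂ : ∀ n → 8 * n + 3 ≡ suc (2 * suc (2 * (2 * n)))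
  eq₂ = ℕ.solve-∀

-- The start is c(4 n + 3) = 0 with q = 3. Each further j replaces q by 4 q + 1, hence 3 q + 1 by 4
-- (3 q + 1), and uses c(4 n + 1) = c(n).
part-ii-coeff : ∀ j → ∃ λ q → 5 * 2 ^ (2 * j + 1) ≡ suc (3 * q) × (∀ n → coeff (2 ^ (2 * j + 2) * n + q) ≡ false)
part-ii-coeff zero = 3 , refl , λ n → trans (cong coeff (eq n)) (coeff-4n+3 n)
  where
  eq : ∀ n → 4 * n + 3 ≡ suc (2 * suc (2 * n))
  eq = ℕ.solve-∀
part-ii-coeff (suc j) with part-ii-coeff j
... | q , eq , vanish = suc (2 * (2 * q)) , 5*2^ , λ n → trans (cong coeff (step n)) (trans (coeff-4n+1 (2 ^ (2 * j + 2) * n + q)) (vanish n))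
  where
  exponent : ∀ j e → 2 * suc j + e ≡ suc (suc (2 * j + e))
  exponent = ℕ.solve-∀
  ring₁ : ∀ t → 5 * (2 * (2 * t)) ≡ 4 * (5 * t)
  ring₁ = ℕ.solve-∀
  ring₂ : ∀ q → 4 * suc (3 * q) ≡ suc (3 * suc (2 * (2 * q)))
  ring₂ = ℕ.solve-∀
  ring₃ : ∀ t n q → 2 * (2 * t) * n + suc (2 * (2 * q)) ≡ suc (2 * (2 * (t * n + q)))
  ring₃ = ℕ.solve-∀
  5*2^ : 5 * 2 ^ (2 * suc j + 1) ≡ suc (3 * suc (2 * (2 * q)))
  5*2^ = trans (cong (λ e → 5 * 2 ^ e) (exponent j 1))
        (trans (ring₁ (2 ^ (2 * j + 1))) (trans (cong (4 *_) eq) (ring₂ q)))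
  step : ∀ n → 2 ^ (2 * suc j + 2) * n + suc (2 * (2 * q)) ≡ suc (2 * (2 * (2 ^ (2 * j + 2) * n + q)))
  step n = trans (cong (λ e → 2 ^ e * n + suc (2 * (2 * q))) (exponent j 2)) (ring₃ (2 ^ (2 * j + 2)) n q)

part-ii : ∀ n j → + 2 ∣ A 7 (2 ^ (2 * j + 3) * n + (10 * 2 ^ (2 * j + 1) + 1) / 3)
part-ii n j with part-ii-coeff j
... | q , eq , vanish = A-even (2 ^ (2 * j + 2) * n + q)
  (trans (cong₂ (λ e B → 2 ^ e * n + (B + 1) / 3) (ℕ.+-suc (2 * j) 2) (ℕ.*-assoc 2 5 (2 ^ (2 * j + 1))))
         (index (2 ^ (2 * j + 2)) n q eq))
  (vanish n)

part-iii : ∀ n → (+ 2 ∣ A 7 (16 * n + 9)) × (+ 2 ∣ A 7 (16 * n + 13))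
part-iii n = A-even (8 * n + 4) (eq₁ n) (coeff-8n+4 n) , A-even (8 * n + 6) (eq₂ n) (coeff-8n+6 n)
  where
  eq₁ : ∀ n → 16 * n + 9 ≡ suc (2 * (8 * n + 4))
  eq₁ = ℕ.solve-∀
  eq₂ : ∀ n → 16 * n + 13 ≡ suc (2 * (8 * n + 6))
  eq₂ = ℕ.solve-∀

-- With X = B = 7^α one has 8 N = 7^α · 8 (3 W + 1), and the last factor modulo 7 depends only on r.
-- For r = 3, 4, 6 it is 3, 6, 5, the three nonresidues.
part-iv : ∀ n α r → (∀ u → (1 * (u * u)) % 7 ≢ (8 * suc (3 * r)) % 7) →
          + 2 ∣ A 7 (2 * 7 ^ α * (7 * n + r) + (2 * 7 ^ α + 1) / 3)
part-iv n α r nonresidue with 7^-1mod3 α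
... | q , eq = A-even (7 ^ α * W + q) (index (7 ^ α) W q eq) (reps-empty (3 * (7 ^ α * W + q))
    λ x y rep → no-rep-7 α (8 * suc (3 * W)) (λ u p → nonresidue u (trans p residue)) x y
      (trans rep (trans (index-form (7 ^ α) W q eq) (ring₁ (7 ^ α) W))))
  where
  W = 7 * n + r
  ring₁ : ∀ X W → 8 * (3 * (X * W) + X) ≡ X * (8 * suc (3 * W))
  ring₁ = ℕ.solve-∀
  ring₂ : ∀ n r → 8 * suc (3 * (7 * n + r)) ≡ 8 * suc (3 * r) + 24 * n * 7
  ring₂ = ℕ.solve-∀
  residue : (8 * suc (3 * W)) % 7 ≡ (8 * suc (3 * r)) % 7
  residue = trans (cong (_% 7) (ring₂ n r)) ([m+kn]%n≡m%n (8 * suc (3 * r)) (24 * n) 7)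

p²-1mod3 : ∀ {p} → Prime p → p > 3 → ∃ λ q → p * p ≡ suc (3 * q)
p²-1mod3 {p} pr p>3 with p % 3 | m≡m%n+[m/n]*n p 3 | m%n<n p 3
... | 0 | eq | _ with prime⇒irreducible pr (ℕ.divides (p / 3) eq)
...   | inj₂ refl = ⊥-elim (ℕ.<-irrefl refl p>3)
p²-1mod3 {p} pr p>3 | 1 | eq | _ = 3 * c * c + 2 * c , trans (cong₂ _*_ eq eq) (ring c)
  where
  c = p / 3
  ring : ∀ c → (1 + c * 3) * (1 + c * 3) ≡ suc (3 * (3 * c * c + 2 * c))
  ring = ℕ.solve-∀
p²-1mod3 {p} pr p>3 | 2 | eq | _ = 3 * c * c + 4 * c + 1 , trans (cong₂ _*_ eq eq) (ring c)
  where
  c = p / 3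
  ring : ∀ c → (2 + c * 3) * (2 + c * 3) ≡ suc (3 * (3 * c * c + 4 * c + 1))
  ring = ℕ.solve-∀
p²-1mod3 {p} pr p>3 | suc (suc (suc _)) | _ | s≤s (s≤s (s≤s ()))

p^-1mod3 : ∀ {p} → Prime p → p > 3 → ∀ α → ∃ λ q → p ^ (2 * α + 2) ≡ suc (3 * q)
p^-1mod3 {p} pr p>3 zero    = subst (λ t → ∃ λ q → p * t ≡ suc (3 * q)) (sym (ℕ.*-identityʳ p)) (p²-1mod3 pr p>3)
p^-1mod3 {p} pr p>3 (suc α) = subst (λ t → ∃ λ q → t ≡ suc (3 * q))
  (trans (ℕ.*-assoc p p _) (cong (p ^_) (sym (exponent α))))
  (1mod3-* (p²-1mod3 pr p>3) (p^-1mod3 pr p>3 α))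
  where
  exponent : ∀ α → 2 * suc α + 2 ≡ suc (suc (2 * α + 2))
  exponent = ℕ.solve-∀

-- With X = p^(2α+1) and B = p X one has 8 N = p^(2α+1) · 8 (3 W + p). The cofactor is prime to p
-- because p > 3 and W ≡ r is nonzero modulo p, so p occurs in 8 N to an odd power.
part-v : ∀ p → Prime p → p > 3 → LegendreMinusOne (- (+ 7)) p → ∀ n α r → 1 ≤ r → r + 1 ≤ p →
         + 2 ∣ A 7 (2 * p ^ (2 * α + 1) * (p * n + r) + (2 * p ^ (2 * α + 2) + 1) / 3)
part-v p pr p>3 legendre n α r 1≤r r<p with p^-1mod3 pr p>3 α
... | q , eq = A-even (X * W + q) (index X W q eq) (reps-empty (3 * (X * W + q))
    λ x y rep → no-rep pr legendre α (8 * (3 * W + p)) p∤ x y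
      (trans rep (trans (index-form X W q eq)
        (trans (cong (λ e → 8 * (3 * (X * W) + p ^ e)) (ℕ.+-suc (2 * α) 1)) (ring X W p)))))
  where
  X = p ^ (2 * α + 1)
  W = p * n + r
  ring : ∀ X W p → 8 * (3 * (X * W) + p * X) ≡ X * (8 * (3 * W + p))
  ring = ℕ.solve-∀
  p∤small : ∀ k .{{_ : NonZero k}} → k ≤ 3 → ¬ p ℕ.∣ k
  p∤small k k≤3 p∣k = ℕ.<-irrefl refl (ℕ.≤-trans p>3 (ℕ.≤-trans (ℕ.∣⇒≤ p∣k) k≤3))
  p∤r : ¬ p ℕ.∣ r
  p∤r p∣r = ℕ.<-irrefl refl (ℕ.≤-trans (subst (_≤ p) (ℕ.+-comm r 1) r<p) (ℕ.∣⇒≤ {{>-nonZero 1≤r}} p∣r))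
  p∤ : ¬ p ℕ.∣ 8 * (3 * W + p)
  p∤ p∣ with euclidsLemma 8 (3 * W + p) pr p∣
  ... | inj₁ p∣8 with euclidsLemma 2 4 pr p∣8
  ...   | inj₁ p∣2 = p∤small 2 (s≤s (s≤s z≤n)) p∣2
  ...   | inj₂ p∣4 = p∤small 2 (s≤s (s≤s z≤n)) (p∣square {x = 2} pr p∣4)
  p∤ p∣ | inj₂ p∣3W+p with euclidsLemma 3 W pr
          (ℕ.∣m+n∣m⇒∣n (subst (p ℕ.∣_) (ℕ.+-comm (3 * W) p) p∣3W+p) ℕ.∣-refl)
  ...   | inj₁ p∣3 = p∤small 3 ℕ.≤-refl p∣3
  ...   | inj₂ p∣W = p∤r (ℕ.∣m+n∣m⇒∣n p∣W (ℕ.m∣m*n n))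

theorem1p8 : ((n : ℕ) → + 2 ∣ (A 7 (2 * n + 1) ℤ.- A 7 (8 * n + 3)))
    × ((n j : ℕ) → + 2 ∣ A 7 (2 ^ (2 * j + 3) * n + (10 * 2 ^ (2 * j + 1) + 1) / 3))
    × ((n : ℕ) → (+ 2 ∣ A 7 (16 * n + 9)) × (+ 2 ∣ A 7 (16 * n + 13)))
    × ((n α : ℕ) →
    (+ 2 ∣ A 7 (2 * 7 ^ α * (7 * n + 3) + (2 * 7 ^ α + 1) / 3))
    × (+ 2 ∣ A 7 (2 * 7 ^ α * (7 * n + 4) + (2 * 7 ^ α + 1) / 3))
    × (+ 2 ∣ A 7 (2 * 7 ^ α * (7 * n + 6) + (2 * 7 ^ α + 1) / 3)))
    × ((p : ℕ) → Prime p → p > 3 → LegendreMinusOne (- (+ 7)) p →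
    (n α r : ℕ) → 1 ≤ r → r + 1 ≤ p →
    + 2 ∣ A 7 (2 * p ^ (2 * α + 1) * (p * n + r) + (2 * p ^ (2 * α + 2) + 1) / 3))
theorem1p8 = part-i , part-ii , part-iii
  , (λ n α → part-iv n α 3 (square-residue 7 1 3) , part-iv n α 4 (square-residue 7 1 6)
           , part-iv n α 6 (square-residue 7 1 5))
  , part-v
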